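{- Let $p$ be a prime and $j\ge 0$ an integer. There is at most one polynomial $P_j$ (with complex coefficients) in the variables $X_w$, where $w\in W$, such that $$\frac{\vartheta_p(j,n)}{\vartheta_p(0,n)}=P_j\bigl((|n|_w)_{w\in W}\bigr)$$ for all integers $n\ge 0$.
   Context: Digits are elements of $\{0,\ldots,p-1\}$. Words are written $w=w_{\mu-1}\cdots w_0$ with $w_{\mu-1}$ leftmost. For a nonnegative integer $n$ with base-$p$ expansion $n=\sum_{i\ge 0}n_ip^i$ (padded with infinitely many zero digits) and a word $w$ of length $\mu$ containing a nonzero digit, $|n|_w=|\{i\ge 0: n_{i+\mu-1}\cdots n_i=w_{\mu-1}\cdots w_0\}|$ is the number of (possibly overlapping) occurrences of $w$ in the expansion of $n$. For $j,n\ge 0$, $\vartheta_p(j,n)=|\{t\in\{0,\ldots,n\}:\nu_p\binom nt=j\}|$, where $\nu_p(m)$ is the exponent of $p$ in $m$. $W$ is the (infinite) set of all words $w_{\mu-1}\cdots w_0$ over $\{0,\ldots,p-1\}$ with $\mu\ge 2$, $w_{\mu-1}\ne 0$ and $w_0\ne p-1$. A polynomial in the variables $X_w$, $w\in W$, involves only finitely many of them. -}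

module Defs where

open import Algebra.Bundles.Raw using (RawRing)
open import Data.Fin.Base using (Fin; toℕ)
import Data.Fin.Properties as Fin
open import Data.Integer.Base using (+_)
open import Data.List.Base using (List; []; _∷_; _++_; filter; foldr; length; map; upTo)
open import Data.List.Extrema.Nat using (max)
open import Data.List.Membership.Propositional using (_∈_)
open import Data.List.Membership.Propositional.Properties using (∈-filter⁺; ∈-upTo⁺)
open import Data.List.Relation.Unary.All using (All; all?)
open import Data.List.Relation.Unary.Any using (here; there)
open import Data.Nat.Base as ℕ using (ℕ; zero; suc; NonZero; z<s; z≤n)
open import Data.Nat.Combinatorics using (_C_; nCk≡nC[n∸k]; nCn≡1)
open import Data.Nat.Divisibility using (_∣_; _∣?_; ∣1⇒≡1)
import Data.Nat.DivMod as ℕ using (_/_; _mod_)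
open import Data.Nat.Primality using (Prime; prime⇒nonZero; ¬prime[1])
import Data.Nat.Properties as ℕ
open import Data.Product.Base using (_×_; _,_; proj₁; proj₂; ∃-syntax)
open import Data.Rational.Base as ℚ using (ℚ; 0ℚ; 1ℚ; ½)
import Data.Rational.Properties as ℚ
open import Data.Rational.Solver using (module +-*-Solver)
open import Data.Vec.Base using (Vec; head; last; tabulate)
import Data.Vec.Properties as Vec
open import Level using (0ℓ)
open import Relation.Binary.Definitions using (DecidableEquality)
open import Relation.Binary.PropositionalEquality
  using (_≡_; _≢_; refl; sym; trans; cong; cong₂; subst; module ≡-Reasoning)
open import Relation.Nullary.Decidable using (Dec; yes; no; map′)
open import Relation.Nullary.Negation using (contradiction)

infix 4 _≈ᴿ_ _≈ᶜ_

IsCauchy : (ℕ → ℚ) → Set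
IsCauchy x = ∀ ε → 0ℚ ℚ.< ε →
  ∃[ N ] (∀ m n → N ℕ.≤ m → N ℕ.≤ n → ℚ.∣ x m ℚ.- x n ∣ ℚ.< ε)

record ℝ : Set where
  constructor mkℝ
  field
    seq    : ℕ → ℚ
    cauchy : IsCauchy seq

open ℝ

_≈ᴿ_ : ℝ → ℝ → Set
x ≈ᴿ y = ∀ ε → 0ℚ ℚ.< ε →
  ∃[ N ] (∀ n → N ℕ.≤ n → ℚ.∣ seq x n ℚ.- seq y n ∣ ℚ.< ε)

module CauchyLemmas where
  0<1 : 0ℚ ℚ.< 1ℚ
  0<1 = ℚ.positive⁻¹ 1ℚ

  half-pos : ∀ {ε} → 0ℚ ℚ.< ε → 0ℚ ℚ.< ½ ℚ.* ε
  half-pos {ε} 0<ε = subst (ℚ._< ½ ℚ.* ε) (ℚ.*-zeroʳ ½) (ℚ.*-monoʳ-<-pos ½ 0<ε)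

  split : ∀ {ε} B → 0ℚ ℚ.< ε → 0ℚ ℚ.< B →
          ∃[ δ ] (0ℚ ℚ.< δ × B ℚ.* δ ≡ ½ ℚ.* ε)
  split {ε} B 0<ε 0<B = δ , 0<δ , eq
    where
    instance
      pB : ℚ.Positive B
      pB = ℚ.positive 0<B
      nB : ℚ.NonZero B
      nB = ℚ.pos⇒nonZero B
      pB⁻¹ : ℚ.Positive (ℚ.1/ B)
      pB⁻¹ = ℚ.1/pos⇒pos B
    δ : ℚ
    δ = (ℚ.1/ B) ℚ.* (½ ℚ.* ε)
    0<δ : 0ℚ ℚ.< δ
    0<δ = subst (ℚ._< δ) (ℚ.*-zeroʳ (ℚ.1/ B)) (ℚ.*-monoʳ-<-pos (ℚ.1/ B) (half-pos 0<ε))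
    eq : B ℚ.* δ ≡ ½ ℚ.* ε
    eq = begin
      B ℚ.* ((ℚ.1/ B) ℚ.* (½ ℚ.* ε))  ≡⟨ ℚ.*-assoc B (ℚ.1/ B) _ ⟨
      (B ℚ.* (ℚ.1/ B)) ℚ.* (½ ℚ.* ε)  ≡⟨ cong (ℚ._* (½ ℚ.* ε)) (ℚ.*-inverseʳ B) ⟩
      1ℚ ℚ.* (½ ℚ.* ε)                ≡⟨ ℚ.*-identityˡ _ ⟩
      ½ ℚ.* ε                         ∎
      where open ≡-Reasoning

  halves : ∀ ε → ½ ℚ.* ε ℚ.+ ½ ℚ.* ε ≡ ε
  halves ε = trans (sym (ℚ.*-distribʳ-+ ε ½ ½)) (ℚ.*-identityˡ ε)

  eventually-bounded : ∀ x → IsCauchy x →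
    ∃[ B ] ∃[ N ] (0ℚ ℚ.< B × (∀ n → N ℕ.≤ n → ℚ.∣ x n ∣ ℚ.≤ B))
  eventually-bounded x cx with cx 1ℚ 0<1
  ... | N , h = B , N , ℚ.<-≤-trans 0<1 1≤B , bound
    where
    B : ℚ
    B = 1ℚ ℚ.+ ℚ.∣ x N ∣
    1≤B : 1ℚ ℚ.≤ B
    1≤B = subst (ℚ._≤ B) (ℚ.+-identityʳ 1ℚ) (ℚ.+-monoʳ-≤ 1ℚ (ℚ.0≤∣p∣ (x N)))
    bound : ∀ n → N ℕ.≤ n → ℚ.∣ x n ∣ ℚ.≤ B
    bound n N≤n = begin
      ℚ.∣ x n ∣                       ≡⟨ cong ℚ.∣_∣ (solve 2 (λ a b → a := (a :- b) :+ b) refl (x n) (x N)) ⟩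
      ℚ.∣ (x n ℚ.- x N) ℚ.+ x N ∣     ≤⟨ ℚ.∣p+q∣≤∣p∣+∣q∣ (x n ℚ.- x N) (x N) ⟩
      ℚ.∣ x n ℚ.- x N ∣ ℚ.+ ℚ.∣ x N ∣ ≤⟨ ℚ.+-monoˡ-≤ ℚ.∣ x N ∣ (ℚ.<⇒≤ (h n N N≤n ℕ.≤-refl)) ⟩
      1ℚ ℚ.+ ℚ.∣ x N ∣                ∎
      where open ℚ.≤-Reasoning
            open +-*-Solver

  +-cauchy : ∀ x y → IsCauchy x → IsCauchy y → IsCauchy (λ n → x n ℚ.+ y n)
  +-cauchy x y cx cy ε 0<ε with cx (½ ℚ.* ε) (half-pos 0<ε) | cy (½ ℚ.* ε) (half-pos 0<ε)
  ... | M , hx | N , hy = M ℕ.⊔ N , λ m n l k → begin-strict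
      ℚ.∣ (x m ℚ.+ y m) ℚ.- (x n ℚ.+ y n) ∣
        ≡⟨ cong ℚ.∣_∣ (solve 4 (λ a b c d → (a :+ b) :- (c :+ d) := (a :- c) :+ (b :- d)) refl (x m) (y m) (x n) (y n)) ⟩
      ℚ.∣ (x m ℚ.- x n) ℚ.+ (y m ℚ.- y n) ∣
        ≤⟨ ℚ.∣p+q∣≤∣p∣+∣q∣ (x m ℚ.- x n) (y m ℚ.- y n) ⟩
      ℚ.∣ x m ℚ.- x n ∣ ℚ.+ ℚ.∣ y m ℚ.- y n ∣
        <⟨ ℚ.+-mono-< (hx m n (ℕ.m⊔n≤o⇒m≤o M N l) (ℕ.m⊔n≤o⇒m≤o M N k))
                      (hy m n (ℕ.m⊔n≤o⇒n≤o M N l) (ℕ.m⊔n≤o⇒n≤o M N k)) ⟩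
      ½ ℚ.* ε ℚ.+ ½ ℚ.* ε
        ≡⟨ halves ε ⟩
      ε ∎
    where open ℚ.≤-Reasoning
          open +-*-Solver

  neg-cauchy : ∀ x → IsCauchy x → IsCauchy (λ n → ℚ.- x n)
  neg-cauchy x cx ε 0<ε with cx ε 0<ε
  ... | N , h = N , λ m n l k → subst (ℚ._< ε) (eq m n) (h m n l k)
    where
    open +-*-Solver
    eq : ∀ m n → ℚ.∣ x m ℚ.- x n ∣ ≡ ℚ.∣ (ℚ.- x m) ℚ.- (ℚ.- x n) ∣
    eq m n = trans (sym (ℚ.∣-p∣≡∣p∣ (x m ℚ.- x n)))
      (cong ℚ.∣_∣ (solve 2 (λ a b → :- (a :- b) := (:- a) :- (:- b)) refl (x m) (x n)))

  *-bound : ∀ a b A δ → 0ℚ ℚ.< A → ℚ.∣ a ∣ ℚ.≤ A → ℚ.∣ b ∣ ℚ.< δ →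
            ℚ.∣ a ℚ.* b ∣ ℚ.< A ℚ.* δ
  *-bound a b A δ 0<A a≤A b<δ = begin-strict
    ℚ.∣ a ℚ.* b ∣       ≡⟨ ℚ.∣p*q∣≡∣p∣*∣q∣ a b ⟩
    ℚ.∣ a ∣ ℚ.* ℚ.∣ b ∣ ≤⟨ ℚ.*-monoʳ-≤-nonNeg ℚ.∣ b ∣ {{ℚ.nonNegative (ℚ.0≤∣p∣ b)}} a≤A ⟩
    A ℚ.* ℚ.∣ b ∣       <⟨ ℚ.*-monoʳ-<-pos A {{ℚ.positive 0<A}} b<δ ⟩
    A ℚ.* δ             ∎
    where open ℚ.≤-Reasoning

  *-difference : ∀ a b c d →
    a ℚ.* b ℚ.- c ℚ.* d ≡ a ℚ.* (b ℚ.- d) ℚ.+ d ℚ.* (a ℚ.- c)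
  *-difference a b c d = begin
    a * b - c * d
      ≡⟨ cong (λ z → a * b + z) (trans (cong -_ (ℚ.*-comm c d)) (ℚ.neg-distribʳ-* d c)) ⟩
    a * b + d * (- c)
      ≡⟨ cong (λ z → z + d * (- c)) (ℚ.+-identityʳ (a * b)) ⟨
    a * b + 0ℚ + d * (- c)
      ≡⟨ cong (λ z → a * b + z + d * (- c)) (ℚ.+-inverseˡ (d * a)) ⟨
    a * b + (- (d * a) + d * a) + d * (- c)
      ≡⟨ cong (λ z → a * b + (z + d * a) + d * (- c))
              (trans (cong -_ (ℚ.*-comm d a)) (ℚ.neg-distribʳ-* a d)) ⟩
    a * b + (a * (- d) + d * a) + d * (- c)
      ≡⟨ cong (λ z → z + d * (- c)) (ℚ.+-assoc (a * b) (a * (- d)) (d * a)) ⟨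
    a * b + a * (- d) + d * a + d * (- c)
      ≡⟨ ℚ.+-assoc (a * b + a * (- d)) (d * a) (d * (- c)) ⟩
    a * b + a * (- d) + (d * a + d * (- c))
      ≡⟨ cong₂ _+_ (ℚ.*-distribˡ-+ a b (- d)) (ℚ.*-distribˡ-+ d a (- c)) ⟨
    a * (b - d) + d * (a - c) ∎
    where open ≡-Reasoning
          open import Data.Rational.Base using (_+_; _*_; _-_; -_)

  *-close : ∀ a b c d A B α β → 0ℚ ℚ.< A → 0ℚ ℚ.< B →
            ℚ.∣ a ∣ ℚ.≤ A → ℚ.∣ d ∣ ℚ.≤ B →
            ℚ.∣ b ℚ.- d ∣ ℚ.< α → ℚ.∣ a ℚ.- c ∣ ℚ.< β →
            ℚ.∣ a ℚ.* b ℚ.- c ℚ.* d ∣ ℚ.< A ℚ.* α ℚ.+ B ℚ.* β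
  *-close a b c d A B α β 0<A 0<B a≤A d≤B b-d<α a-c<β =
    subst (λ z → ℚ.∣ z ∣ ℚ.< A ℚ.* α ℚ.+ B ℚ.* β) (sym (*-difference a b c d))
      (ℚ.≤-<-trans (ℚ.∣p+q∣≤∣p∣+∣q∣ (a ℚ.* (b ℚ.- d)) (d ℚ.* (a ℚ.- c)))
        (ℚ.+-mono-< (*-bound a (b ℚ.- d) A α 0<A a≤A b-d<α)
                    (*-bound d (a ℚ.- c) B β 0<B d≤B a-c<β)))

  *-cauchy : ∀ x y → IsCauchy x → IsCauchy y → IsCauchy (λ n → x n ℚ.* y n)
  *-cauchy x y cx cy ε 0<ε =
    let A , K , 0<A , bx = eventually-bounded x cx
        B , L , 0<B , by = eventually-bounded y cy
        α , 0<α , Aα≡½ε  = split A 0<ε 0<A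
        β , 0<β , Bβ≡½ε  = split B 0<ε 0<B
        M , hx           = cx β 0<β
        N , hy           = cy α 0<α
        R                = (K ℕ.⊔ L) ℕ.⊔ (M ℕ.⊔ N)

        KL≤ : ∀ {m} → R ℕ.≤ m → K ℕ.⊔ L ℕ.≤ m
        KL≤ = ℕ.m⊔n≤o⇒m≤o (K ℕ.⊔ L) (M ℕ.⊔ N)

        MN≤ : ∀ {m} → R ℕ.≤ m → M ℕ.⊔ N ℕ.≤ m
        MN≤ = ℕ.m⊔n≤o⇒n≤o (K ℕ.⊔ L) (M ℕ.⊔ N)
    in R , λ m n l k →
      subst (ℚ.∣ x m ℚ.* y m ℚ.- x n ℚ.* y n ∣ ℚ.<_)
        (trans (cong₂ ℚ._+_ Aα≡½ε Bβ≡½ε) (halves ε))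
        (*-close (x m) (y m) (x n) (y n) A B α β 0<A 0<B
          (bx m (ℕ.m⊔n≤o⇒m≤o K L (KL≤ l)))
          (by n (ℕ.m⊔n≤o⇒n≤o K L (KL≤ k)))
          (hy m n (ℕ.m⊔n≤o⇒n≤o M N (MN≤ l)) (ℕ.m⊔n≤o⇒n≤o M N (MN≤ k)))
          (hx m n (ℕ.m⊔n≤o⇒m≤o M N (MN≤ l)) (ℕ.m⊔n≤o⇒m≤o M N (MN≤ k))))

open CauchyLemmas

infix  8 -ᴿ_
infixl 7 _*ᴿ_
infixl 6 _+ᴿ_

_+ᴿ_ : ℝ → ℝ → ℝ
x +ᴿ y = mkℝ (λ n → seq x n ℚ.+ seq y n) (+-cauchy (seq x) (seq y) (cauchy x) (cauchy y))

_*ᴿ_ : ℝ → ℝ → ℝ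
x *ᴿ y = mkℝ (λ n → seq x n ℚ.* seq y n) (*-cauchy (seq x) (seq y) (cauchy x) (cauchy y))

-ᴿ_ : ℝ → ℝ
-ᴿ x = mkℝ (λ n → ℚ.- seq x n) (neg-cauchy (seq x) (cauchy x))

fromℚᴿ : ℚ → ℝ
fromℚᴿ q = mkℝ (λ _ → q) λ ε 0<ε →
  0 , λ _ _ _ _ → subst (ℚ._< ε) (cong ℚ.∣_∣ (sym (ℚ.+-inverseʳ q))) 0<ε

record ℂ : Set where
  constructor _+i_
  field
    re im : ℝ

open ℂ

_≈ᶜ_ : ℂ → ℂ → Set
z ≈ᶜ w = (re z ≈ᴿ re w) × (im z ≈ᴿ im w)

fromℚ : ℚ → ℂ
fromℚ q = fromℚᴿ q +i fromℚᴿ 0ℚ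

fromℕ : ℕ → ℂ
fromℕ n = fromℚ (+ n ℚ./ 1)

ℂ-rawRing : RawRing 0ℓ 0ℓ
ℂ-rawRing = record
  { Carrier = ℂ
  ; _≈_     = _≈ᶜ_
  ; _+_     = λ z w → (re z +ᴿ re w) +i (im z +ᴿ im w)
  ; _*_     = λ z w → (re z *ᴿ re w +ᴿ -ᴿ (im z *ᴿ im w))
                   +i (re z *ᴿ im w +ᴿ im z *ᴿ re w)
  ; -_      = λ z → (-ᴿ re z) +i (-ᴿ im z)
  ; 0#      = fromℚ 0ℚ
  ; 1#      = fromℚ 1ℚ
  }

module Polynomials {c ℓ} (R : RawRing c ℓ)
                   {i} {I : Set i} (_≟_ : DecidableEquality I) where

  open RawRing R

  -- The product of the listed variables; the order is immaterial and
  -- repetitions give exponents.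
  Monomial : Set i
  Monomial = List I

  exponent : I → Monomial → ℕ
  exponent x m = length (filter (x ≟_) m)

  -- Variables outside m ++ m′ have exponent 0 in both, so only finitely
  -- many exponents have to be compared.
  SameMonomial : Monomial → Monomial → Set i
  SameMonomial m m′ = All (λ x → exponent x m ≡ exponent x m′) (m ++ m′)

  sameMonomial? : ∀ m m′ → Dec (SameMonomial m m′)
  sameMonomial? m m′ = all? (λ x → exponent x m ℕ.≟ exponent x m′) (m ++ m′)

  -- A finite formal sum of terms; the same monomial may occur in
  -- several terms.
  Polynomial : Set _
  Polynomial = List (Carrier × Monomial)

  sum product : List Carrier → Carrier
  sum     = foldr _+_ 0#
  product = foldr _*_ 1#

  coefficient : Monomial → Polynomial → Carrier
  coefficient m P = sum (map proj₁ (filter (λ t → sameMonomial? m (proj₂ t)) P))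

  infix 4 _≈ₚ_

  _≈ₚ_ : Polynomial → Polynomial → Set _
  P ≈ₚ Q = ∀ m → coefficient m P ≈ coefficient m Q

  eval : Polynomial → (I → Carrier) → Carrier
  eval P ρ = sum (map (λ (a , m) → a * product (map ρ m)) P)

-- Words are stored least significant digit first: position k of the
-- vector is w_k, so head is w₀ and last is the leftmost digit.
Word : ℕ → ℕ → Set
Word p μ = Vec (Fin p) μ

-- The length condition μ ≥ 2 is the index 2 + k.  The side conditions
-- are irrelevant so that elements of W are equal when their words are.
record W (p : ℕ) : Set where
  constructor mkW
  field
    {k}            : ℕ
    word           : Word p (2 ℕ.+ k)
    .leftmost≢0    : toℕ (last word) ≢ 0
    .rightmost≢p-1 : toℕ (head word) ≢ p ℕ.∸ 1

open W

infix 4 _≟ᵂ_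

_≟ᵂ_ : ∀ {p} → DecidableEquality (W p)
mkW {k} v _ _ ≟ᵂ mkW {l} w _ _ with k ℕ.≟ l
... | no  k≢l  = no λ { refl → k≢l refl }
... | yes refl = map′ (λ { refl → refl }) (λ { refl → refl })
                      (Vec.≡-dec Fin._≟_ v w)

digit : (p : ℕ) .{{_ : NonZero p}} → ℕ → ℕ → Fin p
digit p n i = (n ℕ./ p ℕ.^ i) ℕ.mod p
  where instance _ = ℕ.m^n≢0 p i

-- For p ≥ 2 we have p ^ i > n whenever i ≥ n, so a window starting at a
-- position i ≥ n consists of zeros only and cannot equal a word with a
-- nonzero digit: it suffices to count the positions i < n.
occurrences : (p : ℕ) .{{_ : NonZero p}} → ∀ {μ} → ℕ → Word p μ → ℕ
occurrences p n w =
  length (filter (λ i → Vec.≡-dec Fin._≟_ (tabulate λ k → digit p n (i ℕ.+ toℕ k)) w)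
                 (upTo n))

-- The largest e with p ^ e ∣ m, for p ≥ 2 and m ≥ 1; such an e
-- satisfies e < p ^ e ≤ m.
ν : ℕ → ℕ → ℕ
ν p m = max 0 (filter (λ e → p ℕ.^ e ∣? m) (upTo (suc m)))

ϑ : ℕ → ℕ → ℕ → ℕ
ϑ p j n = length (filter (λ t → ν p (n C t) ℕ.≟ j) (upTo (suc n)))

private
  ν[1]≡0 : ∀ {p} → Prime p → ν p 1 ≡ 0
  ν[1]≡0 {p} pr with p ℕ.^ 1 ∣? 1
  ... | no  _ = refl
  ... | yes d = contradiction
    (subst Prime (trans (sym (ℕ.*-identityʳ p)) (∣1⇒≡1 d)) pr) ¬prime[1]

  ∈⇒length≢0 : ∀ {x : ℕ} {xs} → x ∈ xs → NonZero (length xs)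
  ∈⇒length≢0 (here _)  = _
  ∈⇒length≢0 (there _) = _

ϑ₀-nonZero : ∀ {p} → Prime p → ∀ n → NonZero (ϑ p 0 n)
ϑ₀-nonZero {p} pr n = ∈⇒length≢0
  (∈-filter⁺ (λ t → ν p (n C t) ℕ.≟ 0) (∈-upTo⁺ z<s)
             (trans (cong (ν p) nC0≡1) (ν[1]≡0 pr)))
  where
  nC0≡1 : n C 0 ≡ 1
  nC0≡1 = trans (nCk≡nC[n∸k] {0} {n} z≤n) (nCn≡1 n)

ϑ-ratio : ∀ {p} → Prime p → ℕ → ℕ → ℚ
ϑ-ratio {p} pr j n = (+ ϑ p j n) ℚ./ ϑ p 0 n
  where instance _ = ϑ₀-nonZero pr n

module _ (p : ℕ) where
  open Polynomials ℂ-rawRing (_≟ᵂ_ {p}) using (Polynomial) public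

module _ {p : ℕ} where
  open Polynomials ℂ-rawRing (_≟ᵂ_ {p}) using (_≈ₚ_; eval) public

occurrenceVector : ∀ {p} → Prime p → ℕ → W p → ℂ
occurrenceVector {p} pr n w = fromℕ (occurrences p n (word w))
  where instance _ = prime⇒nonZero pr

{-# OPTIONS --safe #-}

-- A polynomial of degree at most d over a torsion-free ring that vanishes on a
-- grid s + {0,…,d}^F is zero, so it suffices that the occurrence vectors,
-- restricted to the finite set F of variables in P and Q, contain such a grid.
-- Let n be a concatenation of B blocks (p−1)^M 0^M w with M at least the length
-- of every word in F.  A word v of W neither starts with 0 nor ends with p−1,
-- so |n|_v is the sum of the |w|_v plus B times a constant depending on v only.
-- For w ranging over F (and the empty word, to keep B
-- fixed) the matrix |w|_v is unitriangular with respect to length, and all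
-- vectors of a grid far enough from 0 are reached by back substitution.
module Submission where

open import Defs
open import Algebra.Bundles using (CommutativeRing; CommutativeSemiring)
open import Algebra.Bundles.Raw using (RawRing)
open import Algebra.Structures using (IsCommutativeRing)
open import Data.Bool.Base using (true; false; if_then_else_)
open import Data.Fin.Base as Fin using (Fin; toℕ)
import Data.Fin.Properties as Fin
open import Data.Integer.Base as ℤ using (+≤+)
import Data.Integer.Properties as ℤ
open import Data.List.Base using (List; []; _∷_; _++_; applyUpTo; concatMap; drop; filter;
                                  length; map; replicate)
open import Data.List.Extrema.Nat using (max; xs≤max)
import Data.List.Membership.DecPropositional as DecMembership
open import Data.List.Membership.Propositional using (_∈_; _∉_)
open import Data.List.Membership.Propositional.Properties using (∈-++⁺ˡ; ∈-++⁺ʳ; ∈-filter⁻)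
open import Data.List.Properties
  using (filter-accept; filter-reject; filter-none; length-filter; ++-assoc; ++-identityʳ;
         length-++; length-replicate; map-++)
open import Data.List.Relation.Unary.All as All using (All; []; _∷_)
import Data.List.Relation.Unary.All.Properties as All
open import Data.List.Relation.Unary.AllPairs using (AllPairs; []; _∷_)
open import Data.List.Relation.Unary.Any using (here; there)
open import Data.Nat.Base as ℕ using (ℕ; zero; suc; z<s; s<s; s≤s; z≤n)
open import Data.Nat.DivMod as ℕ using (_/_; _%_)
open import Data.Nat.Divisibility using (n∣m*n)
open import Data.Nat.ListAction using (sum)
open import Data.Nat.ListAction.Properties using (sum-++)
open import Data.Nat.Primality using (Prime; prime⇒nonZero; ¬prime[0]; ¬prime[1])
import Data.Nat.Properties as ℕ
import Data.Nat.Solver as ℕ-Solver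
open import Data.Product.Base using (_×_; _,_; proj₁; proj₂; ∃-syntax)
open import Data.Rational.Base as ℚ using (ℚ; 0ℚ; 1ℚ; ½)
import Data.Rational.Properties as ℚ
open import Data.Rational.Solver using (module +-*-Solver)
open import Data.Rational.Unnormalised.Base as ℚᵘ using (mkℚᵘ; *≡*; *≤*)
import Data.Rational.Unnormalised.Properties as ℚᵘ
open import Data.Unit.Base using (⊤; tt)
open import Data.Vec.Base using (Vec; []; _∷_; head; last; lookup; tabulate; toList)
import Data.Vec.Properties as Vec
open import Function.Base using (_∘_; id)
open import Relation.Binary.Definitions using (DecidableEquality)
open import Relation.Binary.PropositionalEquality as ≡ using (_≡_; _≢_; refl; module ≡-Reasoning)
open import Relation.Nullary.Decidable using (Dec; does; yes; no; ¬?; dec-true; dec-false)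
open import Relation.Nullary.Negation using (¬_; contradiction)
open import Relation.Nullary.Recomputable using (¬-recompute)

open CauchyLemmas
open ℝ
open ℂ

-- Equality in this model of the complex numbers is an undecidable statement about limits, so no
-- case distinction can find a nonzero leading coefficient or compare a root count with a degree.
-- Each coefficient is shown to vanish directly: synthetic division at the first root leaves a
-- quotient whose values at the other roots are freed from a positive integer factor, a cancellation
-- that needs no apartness. This is why the grid consists of consecutive integers.
--
-- The grid starts away from 0 because back substitution can only add copies of a word: its count
-- must be raised to a level above everything that the longer words may already contribute,
-- whichever grid point is aimed at. The number of blocks has to be uniform for a similar reason: a
-- separator has occurrences of its own, for instance of the two-digit word with leftmost digit p-1
-- and rightmost digit 0, and they amount to a constant shift only if all grid points use equally
-- many separators.

module _ {i} {I : Set i} (_≟_ : DecidableEquality I) where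

  update : I → ℕ → (I → ℕ) → I → ℕ
  update x i g y = if does (x ≟ y) then i else g y

  update-≡ : ∀ x i g → update x i g x ≡ i
  update-≡ x i g rewrite dec-true (x ≟ x) refl = refl

  update-≢ : ∀ x y i g → x ≢ y → update x i g y ≡ g y
  update-≢ x y i g x≢y rewrite dec-false (x ≟ y) x≢y = refl

  update-≤ : ∀ {d} x i {g} → i ℕ.≤ d → (∀ y → g y ℕ.≤ d) → ∀ y → update x i g y ℕ.≤ d
  update-≤ x i i≤d g≤d y with does (x ≟ y)
  ... | true  = i≤d
  ... | false = g≤d y

module _ {c ℓ} (R : RawRing c ℓ) where

  open RawRing R

  IsCommutative : Set _
  IsCommutative = IsCommutativeRing _≈_ _+_ _*_ -_ 0# 1#

  IsAdditive : (ℕ → Carrier) → Set ℓ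
  IsAdditive ι = ∀ m n → ι (m ℕ.+ n) ≈ ι m + ι n

  -- Torsion-freeness. With `IsAdditive`, the difference of two grid points `ι (s + suc i)` and
  -- `ι s` is the cancellable factor `ι (suc i)`.
  PositivesCancel : (ℕ → Carrier) → Set _
  PositivesCancel ι = ∀ n z → ι (suc n) * z ≈ 0# → z ≈ 0#

module GridVanishing {c ℓ} (R : RawRing c ℓ) (R-comm : IsCommutative R) (ι : ℕ → RawRing.Carrier R)
                     (ι-+ : IsAdditive R ι) (ι-cancel : PositivesCancel R ι) where

  commutativeRing : CommutativeRing c ℓ
  commutativeRing = record { isCommutativeRing = R-comm }

  open CommutativeRing commutativeRing hiding (rawRing) renaming (refl to ≈-refl)
  open import Algebra.Solver.Ring.NaturalCoefficients.Default commutativeSemiring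
    using (solve; _:=_; _:+_; _:*_; con)
  open import Algebra.Definitions.RawSemiring (CommutativeSemiring.rawSemiring commutativeSemiring) using (_^_)
  open import Algebra.Properties.Ring ring
    using (-0#≈0#; -‿+-comm; -‿distribˡ-*; x∙y⁻¹≈ε⇒x≈y; x≈y⇒x∙y⁻¹≈ε)
  open import Relation.Binary.Reasoning.Setoid setoid

  -- One variable: Horner's scheme and consecutive roots

  horner : ℕ → (ℕ → Carrier) → Carrier → Carrier
  horner zero    c x = 0#
  horner (suc n) c x = c 0 + x * horner n (c ∘ suc) x

  horner-cong : ∀ n {c d x y} → (∀ i → c i ≈ d i) → x ≈ y → horner n c x ≈ horner n d y
  horner-cong zero    c≈d x≈y = ≈-refl
  horner-cong (suc n) c≈d x≈y =
    +-cong (c≈d 0) (*-cong x≈y (horner-cong n (c≈d ∘ suc) x≈y))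

  horner-+ : ∀ n c d x → horner n (λ i → c i + d i) x ≈ horner n c x + horner n d x
  horner-+ zero    c d x = sym (+-identityˡ 0#)
  horner-+ (suc n) c d x = begin
    c 0 + d 0 + x * horner n (λ i → c (suc i) + d (suc i)) x
      ≈⟨ +-congˡ (*-congˡ (horner-+ n (c ∘ suc) (d ∘ suc) x)) ⟩
    c 0 + d 0 + x * (horner n (c ∘ suc) x + horner n (d ∘ suc) x)
      ≈⟨ solve 5 (λ a b x u v → a :+ b :+ x :* (u :+ v) := a :+ x :* u :+ (b :+ x :* v))
           ≈-refl (c 0) (d 0) x (horner n (c ∘ suc) x) (horner n (d ∘ suc) x) ⟩
    c 0 + x * horner n (c ∘ suc) x + (d 0 + x * horner n (d ∘ suc) x) ∎

  horner-zero : ∀ n c x → (∀ i → c i ≈ 0#) → horner n c x ≈ 0#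
  horner-zero zero    c x c≈0 = ≈-refl
  horner-zero (suc n) c x c≈0 = begin
    c 0 + x * horner n (c ∘ suc) x ≈⟨ +-cong (c≈0 0) (*-congˡ (horner-zero n (c ∘ suc) x (c≈0 ∘ suc))) ⟩
    0# + x * 0#                    ≈⟨ +-identityˡ _ ⟩
    x * 0#                         ≈⟨ zeroʳ x ⟩
    0#                             ∎

  horner-single : ∀ n c x {k} → k ℕ.< n → (∀ i → i ≢ k → c i ≈ 0#) → horner n c x ≈ x ^ k * c k
  horner-single (suc n) c x {zero} _ c≈0 = begin
    c 0 + x * horner n (c ∘ suc) x ≈⟨ +-congˡ (*-congˡ (horner-zero n (c ∘ suc) x λ i → c≈0 (suc i) λ ())) ⟩
    c 0 + x * 0#                   ≈⟨ +-congˡ (zeroʳ x) ⟩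
    c 0 + 0#                       ≈⟨ +-identityʳ (c 0) ⟩
    c 0                            ≈⟨ *-identityˡ (c 0) ⟨
    1# * c 0                       ∎
  horner-single (suc n) c x {suc k} (s<s k<n) c≈0 = begin
    c 0 + x * horner n (c ∘ suc) x
      ≈⟨ +-cong (c≈0 0 λ ()) (*-congˡ (horner-single n (c ∘ suc) x k<n
           λ i i≢k → c≈0 (suc i) (i≢k ∘ ℕ.suc-injective))) ⟩
    0# + x * (x ^ k * c (suc k))   ≈⟨ +-identityˡ _ ⟩
    x * (x ^ k * c (suc k))        ≈⟨ *-assoc x (x ^ k) (c (suc k)) ⟨
    x * x ^ k * c (suc k)          ∎

  -- Synthetic division of horner (suc n) c by X − s: the partial results of
  -- Horner's scheme at s are the remainder followed by the coefficients of
  -- the quotient.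
  partials : ℕ → (ℕ → Carrier) → Carrier → ℕ → Carrier
  partials zero    c s i       = 0#
  partials (suc n) c s zero    = horner (suc n) c s
  partials (suc n) c s (suc i) = partials n (c ∘ suc) s i

  quotient : ℕ → (ℕ → Carrier) → Carrier → ℕ → Carrier
  quotient n c s = partials n (c ∘ suc) s

  -- Writing the point as `s + δ` keeps the identity free of subtraction; at a grid point `δ`
  -- becomes the positive integer to be cancelled.
  horner-division : ∀ n c s δ → horner (suc n) c (s + δ) ≈
    horner (suc n) c s + δ * horner n (quotient n c s) (s + δ)
  horner-division zero c s δ =
    solve 3 (λ c s δ → c :+ (s :+ δ) :* con 0 := c :+ s :* con 0 :+ δ :* con 0)
      ≈-refl (c 0) s δ
  horner-division (suc n) c s δ = begin
    c 0 + (s + δ) * horner (suc n) (c ∘ suc) (s + δ)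
      ≈⟨ +-congˡ (*-congˡ (horner-division n (c ∘ suc) s δ)) ⟩
    c 0 + (s + δ) * (r + δ * q)
      ≈⟨ solve 5 (λ c s δ r q → c :+ (s :+ δ) :* (r :+ δ :* q) :=
                   c :+ s :* r :+ δ :* (r :+ (s :+ δ) :* q))
           ≈-refl (c 0) s δ r q ⟩
    c 0 + s * r + δ * (r + (s + δ) * q) ∎
    where
    r = horner (suc n) (c ∘ suc) s
    q = horner n (quotient n (c ∘ suc) s) (s + δ)

  partials≈0⇒horner≈0 : ∀ n c s → (∀ i → i ℕ.< n → partials n c s i ≈ 0#) → horner n c s ≈ 0#
  partials≈0⇒horner≈0 zero    c s h = ≈-refl
  partials≈0⇒horner≈0 (suc n) c s h = h 0 z<s

  -- Horner's scheme is invertible: a coefficient is a partial result minus `s` times the next one.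
  partials≈0⇒coefficients≈0 : ∀ n c s → (∀ i → i ℕ.< n → partials n c s i ≈ 0#) →
                              ∀ i → i ℕ.< n → c i ≈ 0#
  partials≈0⇒coefficients≈0 (suc n) c s h zero    _ = begin
    c 0                            ≈⟨ +-identityʳ (c 0) ⟨
    c 0 + 0#                       ≈⟨ +-congˡ (zeroʳ s) ⟨
    c 0 + s * 0#
      ≈⟨ +-congˡ (*-congˡ (partials≈0⇒horner≈0 n (c ∘ suc) s λ i i<n → h (suc i) (s<s i<n))) ⟨
    c 0 + s * horner n (c ∘ suc) s ≈⟨ h 0 z<s ⟩
    0#                             ∎
  partials≈0⇒coefficients≈0 (suc n) c s h (suc i) (s<s i<n) =
    partials≈0⇒coefficients≈0 n (c ∘ suc) s (λ i i<n → h (suc i) (s<s i<n)) i i<n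

  -- The root at `ι s` kills the remainder. At the later points the value is `ι (suc i)` times that
  -- of the quotient, so the quotient, with one coefficient fewer, vanishes at the progression that
  -- starts at `suc s`.
  horner-vanishing : ∀ n c s → (∀ i → i ℕ.< n → horner n c (ι (s ℕ.+ i)) ≈ 0#) →
                     ∀ i → i ℕ.< n → c i ≈ 0#
  horner-vanishing (suc n) c s h = partials≈0⇒coefficients≈0 (suc n) c (ι s) λ where
      zero    _         → root
      (suc i) (s<s i<n) → horner-vanishing n (quotient n c (ι s)) (suc s) quotient-root i i<n
    where
    root : horner (suc n) c (ι s) ≈ 0#
    root = ≡.subst (λ m → horner (suc n) c (ι m) ≈ 0#) (ℕ.+-identityʳ s) (h 0 z<s)

    quotient-root : ∀ i → i ℕ.< n → horner n (quotient n c (ι s)) (ι (suc s ℕ.+ i)) ≈ 0#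
    quotient-root i i<n = ι-cancel i _ (begin
      ι (suc i) * horner n (quotient n c (ι s)) (ι (suc s ℕ.+ i))
        ≈⟨ *-congˡ (horner-cong n (λ _ → ≈-refl) shift) ⟩
      δ * horner n (quotient n c (ι s)) (ι s + δ)
        ≈⟨ +-identityˡ _ ⟨
      0# + δ * horner n (quotient n c (ι s)) (ι s + δ)
        ≈⟨ +-congʳ root ⟨
      horner (suc n) c (ι s) + δ * horner n (quotient n c (ι s)) (ι s + δ)
        ≈⟨ horner-division n c (ι s) δ ⟨
      horner (suc n) c (ι s + δ)
        ≈⟨ horner-cong (suc n) {c} (λ _ → ≈-refl) (ι-+ s (suc i)) ⟨
      horner (suc n) c (ι (s ℕ.+ suc i))
        ≈⟨ h (suc i) (s<s i<n) ⟩
      0# ∎)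
      where
      δ = ι (suc i)
      shift : ι (suc s ℕ.+ i) ≈ ι s + δ
      shift = trans (reflexive (≡.cong ι (≡.sym (ℕ.+-suc s i)))) (ι-+ s (suc i))

  -- Several variables: expansion in powers of one variable

  module _ {i} {I : Set i} (_≟_ : DecidableEquality I) where
    open Polynomials R _≟_
      using (Monomial; exponent; SameMonomial; sameMonomial?; coefficient)
      renaming (Polynomial to Poly; eval to evaluate; product to productᴿ; sum to sumᴿ)

    open DecMembership _≟_ using (_∈?_)

    strip : I → Monomial → Monomial
    strip x = filter (¬? ∘ (x ≟_))

    -- The coefficient of the `e`-th power of `x` when `P` is read as a polynomial in `x` over the
    -- remaining variables.
    slice : I → ℕ → Poly → Poly
    slice x e P = map (λ (a , m) → a , strip x m) (filter (λ t → exponent x (proj₂ t) ℕ.≟ e) P)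

    product-strip : ∀ ρ x m → productᴿ (map ρ m) ≈ ρ x ^ exponent x m * productᴿ (map ρ (strip x m))
    product-strip ρ x [] = sym (*-identityˡ 1#)
    product-strip ρ x (y ∷ m) with x ≟ y
    ... | yes refl = trans (*-congˡ (product-strip ρ x m)) (sym (*-assoc _ _ _))
    ... | no  _    = trans (*-congˡ (product-strip ρ x m))
      (solve 3 (λ a b c → a :* (b :* c) := b :* (a :* c)) ≈-refl _ _ _)

    evaluate-slices : ∀ n ρ x P → All (λ t → exponent x (proj₂ t) ℕ.< n) P →
                  evaluate P ρ ≈ horner n (λ e → evaluate (slice x e P) ρ) (ρ x)
    evaluate-slices n ρ x [] [] = sym (horner-zero n (λ _ → 0#) (ρ x) λ _ → ≈-refl)
    evaluate-slices n ρ x ((a , m) ∷ P) (k<n ∷ P<n) = begin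
      a * productᴿ (map ρ m) + evaluate P ρ
        ≈⟨ +-cong term≈ (evaluate-slices n ρ x P P<n) ⟩
      horner n single (ρ x) + horner n (λ e → evaluate (slice x e P) ρ) (ρ x)
        ≈⟨ horner-+ n _ _ (ρ x) ⟨
      horner n (λ e → single e + evaluate (slice x e P) ρ) (ρ x)
        ≈⟨ horner-cong n slice-∷ ≈-refl ⟩
      horner n (λ e → evaluate (slice x e ((a , m) ∷ P)) ρ) (ρ x) ∎
      where
      k = exponent x m
      b = a * productᴿ (map ρ (strip x m))

      -- The coefficient sequence of the head term alone; prepending a term to `P` then becomes an
      -- addition of sequences.
      single : ℕ → Carrier
      single e with k ℕ.≟ e
      ... | yes _ = b
      ... | no  _ = 0#

      single-≡ : single k ≈ b
      single-≡ with k ℕ.≟ k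
      ... | yes _  = ≈-refl
      ... | no k≢k = contradiction refl k≢k

      single-≢ : ∀ e → e ≢ k → single e ≈ 0#
      single-≢ e e≢k with k ℕ.≟ e
      ... | yes k≡e = contradiction (≡.sym k≡e) e≢k
      ... | no  _   = ≈-refl

      slice-∷ : ∀ e → single e + evaluate (slice x e P) ρ ≈ evaluate (slice x e ((a , m) ∷ P)) ρ
      slice-∷ e with k ℕ.≟ e
      ... | yes k≡e rewrite dec-true (k ℕ.≟ e) k≡e = ≈-refl
      ... | no  k≢e rewrite dec-false (k ℕ.≟ e) k≢e = +-identityˡ _

      term≈ : a * productᴿ (map ρ m) ≈ horner n single (ρ x)
      term≈ = begin
        a * productᴿ (map ρ m)
          ≈⟨ *-congˡ (product-strip ρ x m) ⟩
        a * (ρ x ^ k * productᴿ (map ρ (strip x m)))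
          ≈⟨ solve 3 (λ a b c → a :* (b :* c) := b :* (a :* c)) ≈-refl _ _ _ ⟩
        ρ x ^ k * b
          ≈⟨ *-congˡ single-≡ ⟨
        ρ x ^ k * single k
          ≈⟨ horner-single n single (ρ x) k<n single-≢ ⟨
        horner n single (ρ x) ∎

    exponent-∉ : ∀ x m → x ∉ m → exponent x m ≡ 0
    exponent-∉ x m x∉m = ≡.cong length (filter-none (x ≟_) (All.¬Any⇒All¬ _ x∉m))

    same⇒exponents : ∀ m m′ → SameMonomial m m′ → ∀ x → exponent x m ≡ exponent x m′
    same⇒exponents m m′ same x with x ∈? (m ++ m′)
    ... | yes x∈ = All.lookup same x∈
    ... | no  x∉ = ≡.trans (exponent-∉ x m (x∉ ∘ ∈-++⁺ˡ)) (≡.sym (exponent-∉ x m′ (x∉ ∘ ∈-++⁺ʳ m)))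

    exponents⇒same : ∀ m m′ → (∀ x → exponent x m ≡ exponent x m′) → SameMonomial m m′
    exponents⇒same m m′ eq = All.tabulate (λ {x} _ → eq x)

    exponent-strip-≡ : ∀ x m → exponent x (strip x m) ≡ 0
    exponent-strip-≡ x m = exponent-∉ x (strip x m) λ x∈ → proj₂ (∈-filter⁻ (¬? ∘ (x ≟_)) {xs = m} x∈) refl

    exponent-strip-≢ : ∀ {x y} m → y ≢ x → exponent y (strip x m) ≡ exponent y m
    exponent-strip-≢ [] y≢x = refl
    exponent-strip-≢ {x} {y} (z ∷ m) y≢x with x ≟ z
    ... | yes refl rewrite dec-false (y ≟ x) y≢x = exponent-strip-≢ m y≢x
    ... | no  _ with does (y ≟ z)
    ...   | true  = ≡.cong suc (exponent-strip-≢ m y≢x)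
    ...   | false = exponent-strip-≢ m y≢x

    strip-same : ∀ x m m′ → SameMonomial m m′ → SameMonomial (strip x m) (strip x m′)
    strip-same x m m′ same = exponents⇒same (strip x m) (strip x m′) λ y → helper y (y ≟ x)
      where
      helper : ∀ y → Dec (y ≡ x) → exponent y (strip x m) ≡ exponent y (strip x m′)
      helper y (yes refl) = ≡.trans (exponent-strip-≡ x m) (≡.sym (exponent-strip-≡ x m′))
      helper y (no  y≢x)  = ≡.trans (exponent-strip-≢ m y≢x)
        (≡.trans (same⇒exponents m m′ same y) (≡.sym (exponent-strip-≢ m′ y≢x)))

    strip-same⁻ : ∀ x m m′ → exponent x m′ ≡ exponent x m →
                  SameMonomial (strip x m) (strip x m′) → SameMonomial m m′
    strip-same⁻ x m m′ x-eq same = exponents⇒same m m′ λ y → helper y (y ≟ x)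
      where
      helper : ∀ y → Dec (y ≡ x) → exponent y m ≡ exponent y m′
      helper y (yes refl) = ≡.sym x-eq
      helper y (no  y≢x)  = ≡.trans (≡.sym (exponent-strip-≢ m y≢x))
        (≡.trans (same⇒exponents (strip x m) (strip x m′) same y) (exponent-strip-≢ m′ y≢x))

    coefficient-accept : ∀ m m′ a P → SameMonomial m m′ →
                         coefficient m ((a , m′) ∷ P) ≡ a + coefficient m P
    coefficient-accept m m′ a P same =
      ≡.cong (sumᴿ ∘ map proj₁) (filter-accept (λ t → sameMonomial? m (proj₂ t)) same)

    coefficient-reject : ∀ m m′ a P → ¬ SameMonomial m m′ →
                         coefficient m ((a , m′) ∷ P) ≡ coefficient m P
    coefficient-reject m m′ a P ¬same =
      ≡.cong (sumᴿ ∘ map proj₁) (filter-reject (λ t → sameMonomial? m (proj₂ t)) ¬same)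

    slice-accept : ∀ x e m a P → exponent x m ≡ e → slice x e ((a , m) ∷ P) ≡ (a , strip x m) ∷ slice x e P
    slice-accept x e m a P k≡e =
      ≡.cong (map λ t → proj₁ t , strip x (proj₂ t))
             (filter-accept (λ t → exponent x (proj₂ t) ℕ.≟ e) {a , m} {P} k≡e)

    slice-reject : ∀ x e m a P → exponent x m ≢ e → slice x e ((a , m) ∷ P) ≡ slice x e P
    slice-reject x e m a P k≢e =
      ≡.cong (map λ t → proj₁ t , strip x (proj₂ t))
             (filter-reject (λ t → exponent x (proj₂ t) ℕ.≟ e) {a , m} {P} k≢e)

    -- Every term with monomial `m` survives the slicing, and among the survivors the exponent of
    -- `x` is fixed, so deleting `x` makes no further monomial equal to `m`.
    coefficient-slice : ∀ x m P → coefficient m P ≈ coefficient (strip x m) (slice x (exponent x m) P)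
    coefficient-slice x m [] = ≈-refl
    coefficient-slice x m ((a , m′) ∷ P) =
      step (exponent x m′ ℕ.≟ exponent x m) (sameMonomial? m m′)
      where
      slicedP = slice x (exponent x m) P

      step : Dec (exponent x m′ ≡ exponent x m) → Dec (SameMonomial m m′) →
             coefficient m ((a , m′) ∷ P) ≈
             coefficient (strip x m) (slice x (exponent x m) ((a , m′) ∷ P))
      step (no x-neq) (yes same) = contradiction (≡.sym (same⇒exponents m m′ same x)) x-neq
      step (no x-neq) (no ¬same) = begin
        coefficient m ((a , m′) ∷ P)    ≡⟨ coefficient-reject m m′ a P ¬same ⟩
        coefficient m P                 ≈⟨ coefficient-slice x m P ⟩
        coefficient (strip x m) slicedP
          ≡⟨ ≡.cong (coefficient (strip x m)) (slice-reject x (exponent x m) m′ a P x-neq) ⟨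
        coefficient (strip x m) (slice x (exponent x m) ((a , m′) ∷ P)) ∎
      step (yes x-eq) (yes same) = begin
        coefficient m ((a , m′) ∷ P)        ≡⟨ coefficient-accept m m′ a P same ⟩
        a + coefficient m P                 ≈⟨ +-congˡ (coefficient-slice x m P) ⟩
        a + coefficient (strip x m) slicedP
          ≡⟨ coefficient-accept (strip x m) (strip x m′) a slicedP (strip-same x m m′ same) ⟨
        coefficient (strip x m) ((a , strip x m′) ∷ slicedP)
          ≡⟨ ≡.cong (coefficient (strip x m)) (slice-accept x (exponent x m) m′ a P x-eq) ⟨
        coefficient (strip x m) (slice x (exponent x m) ((a , m′) ∷ P)) ∎
      step (yes x-eq) (no ¬same) = begin
        coefficient m ((a , m′) ∷ P)    ≡⟨ coefficient-reject m m′ a P ¬same ⟩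
        coefficient m P                 ≈⟨ coefficient-slice x m P ⟩
        coefficient (strip x m) slicedP
          ≡⟨ coefficient-reject (strip x m) (strip x m′) a slicedP (¬same ∘ strip-same⁻ x m m′ x-eq) ⟨
        coefficient (strip x m) ((a , strip x m′) ∷ slicedP)
          ≡⟨ ≡.cong (coefficient (strip x m)) (slice-accept x (exponent x m) m′ a P x-eq) ⟨
        coefficient (strip x m) (slice x (exponent x m) ((a , m′) ∷ P)) ∎

    product-local : ∀ {ρ ρ′ : I → Carrier} m → All (λ x → ρ x ≈ ρ′ x) m →
                    productᴿ (map ρ m) ≈ productᴿ (map ρ′ m)
    product-local []      []       = ≈-refl
    product-local (_ ∷ m) (e ∷ es) = *-cong e (product-local m es)

    evaluate-local : ∀ {ρ ρ′} P → All (λ t → All (λ x → ρ x ≈ ρ′ x) (proj₂ t)) P →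
                     evaluate P ρ ≈ evaluate P ρ′
    evaluate-local [] []       = ≈-refl
    evaluate-local ((_ , m) ∷ P) (e ∷ es) = +-cong (*-congˡ (product-local m e)) (evaluate-local P es)

    All-slice : ∀ {ℓ₁ ℓ₂} {S : Monomial → Set ℓ₁} {T : Monomial → Set ℓ₂} x e P →
                (∀ m → S m → T (strip x m)) →
                All (S ∘ proj₂) P → All (T ∘ proj₂) (slice x e P)
    All-slice x e P S⇒T all = All.map⁺
      (All.map (λ {t} → S⇒T (proj₂ t)) (All.filter⁺ (λ t → exponent x (proj₂ t) ℕ.≟ e) all))

    slice-large : ∀ x e n P → All (λ t → exponent x (proj₂ t) ℕ.< n) P → n ℕ.≤ e → slice x e P ≡ []
    slice-large x e n P P<n n≤e = ≡.cong (map λ t → proj₁ t , strip x (proj₂ t))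
      (filter-none (λ t → exponent x (proj₂ t) ℕ.≟ e)
      (All.map (λ k<n k≡e → ℕ.<⇒≱ k<n (ℕ.≤-trans n≤e (ℕ.≤-reflexive (≡.sym k≡e)))) P<n))

    -- With the other coordinates fixed, `P` is a polynomial in `x` with at most `d + 1`
    -- coefficients, the values of its slices, and it has `d + 1` consecutive roots. So every slice
    -- vanishes on the grid, and slices involve only the variables in the rest of `F`. Repetitions
    -- in `F` are harmless: a second pass over `x` meets only exponent 0.
    grid-vanishing : ∀ (F : List I) d (s : I → ℕ) P →
      All (λ t → All (_∈ F) (proj₂ t)) P →
      All (λ t → length (proj₂ t) ℕ.≤ d) P →
      (∀ g → (∀ x → g x ℕ.≤ d) → evaluate P (λ x → ι (s x ℕ.+ g x)) ≈ 0#) →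
      ∀ m → coefficient m P ≈ 0#
    grid-vanishing [] d s P P⊆F _ P≈0 m = vanish m
      where
      ρ : I → Carrier
      ρ x = ι (s x ℕ.+ 0)

      constant-coefficient : ∀ Q → All (λ t → All (_∈ []) (proj₂ t)) Q → coefficient [] Q ≈ evaluate Q ρ
      constant-coefficient []            _         = ≈-refl
      constant-coefficient ((a , []) ∷ Q) (_ ∷ Q⊆) = +-cong (sym (*-identityʳ a)) (constant-coefficient Q Q⊆)
      constant-coefficient ((a , _ ∷ _) ∷ Q) ((() ∷ _) ∷ _)

      nonconstant-coefficient : ∀ x m Q → All (λ t → All (_∈ []) (proj₂ t)) Q → coefficient (x ∷ m) Q ≈ 0#
      nonconstant-coefficient x m []             _        = ≈-refl
      nonconstant-coefficient x m ((a , []) ∷ Q) (_ ∷ Q⊆) =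
        trans (reflexive (coefficient-reject (x ∷ m) [] a Q differ)) (nonconstant-coefficient x m Q Q⊆)
        where
        differ : ¬ SameMonomial (x ∷ m) []
        differ same with () ← ≡.trans (≡.sym (≡.cong length (filter-accept (x ≟_) {x} {xs = m} refl)))
                                      (same⇒exponents (x ∷ m) [] same x)
      nonconstant-coefficient x m ((a , _ ∷ _) ∷ Q) ((() ∷ _) ∷ _)

      vanish : ∀ m → coefficient m P ≈ 0#
      vanish []      = trans (constant-coefficient P P⊆F) (P≈0 (λ _ → 0) (λ _ → z≤n))
      vanish (x ∷ m) = nonconstant-coefficient x m P P⊆F

    grid-vanishing (x ∷ F) d s P P⊆F P≤d P≈0 m = trans (coefficient-slice x m P)
      (grid-vanishing F d s (slice x e P)
        (All-slice x e P ⊆-strip P⊆F)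
        (All-slice x e P (λ m → ℕ.≤-trans (length-filter (¬? ∘ (x ≟_)) m)) P≤d)
        slice≈0 (strip x m))
      where
      e = exponent x m

      exponents<1+d : All (λ t → exponent x (proj₂ t) ℕ.< suc d) P
      exponents<1+d = All.map (λ {t} l → s≤s (ℕ.≤-trans (length-filter (x ≟_) (proj₂ t)) l)) P≤d

      ⊆-strip : ∀ m → All (_∈ x ∷ F) m → All (_∈ F) (strip x m)
      ⊆-strip m m⊆ = All.zipWith drop-x (All.all-filter (¬? ∘ (x ≟_)) m , All.filter⁺ (¬? ∘ (x ≟_)) m⊆)
        where
        drop-x : ∀ {y} → x ≢ y × y ∈ x ∷ F → y ∈ F
        drop-x (x≢y , here y≡x)  = contradiction (≡.sym y≡x) x≢y
        drop-x (_   , there y∈F) = y∈F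

      slice≈0 : ∀ g → (∀ y → g y ℕ.≤ d) → evaluate (slice x e P) (λ y → ι (s y ℕ.+ g y)) ≈ 0#
      slice≈0 g g≤d with e ℕ.<? suc d
      -- The monomial `m` is arbitrary, so its exponent of `x` may exceed `d`; no term of `P` has
      -- such an exponent.
      ... | no e≮1+d rewrite slice-large x e (suc d) P exponents<1+d (ℕ.≮⇒≥ e≮1+d) = ≈-refl
      ... | yes e<1+d = horner-vanishing (suc d) (λ e → evaluate (slice x e P) ρ) (s x) root e e<1+d
        where
        ρ : I → Carrier
        ρ y = ι (s y ℕ.+ g y)

        root : ∀ i → i ℕ.< suc d → horner (suc d) (λ e → evaluate (slice x e P) ρ) (ι (s x ℕ.+ i)) ≈ 0#
        root i (s≤s i≤d) = begin
          horner (suc d) (λ e → evaluate (slice x e P) ρ) (ι (s x ℕ.+ i))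
            ≈⟨ horner-cong (suc d) independent (reflexive (≡.cong (λ j → ι (s x ℕ.+ j)) (update-≡ _≟_ x i g))) ⟨
          horner (suc d) (λ e → evaluate (slice x e P) ρ′) (ρ′ x)
            ≈⟨ evaluate-slices (suc d) ρ′ x P exponents<1+d ⟨
          evaluate P ρ′
            ≈⟨ P≈0 (update _≟_ x i g) (update-≤ _≟_ x i i≤d g≤d) ⟩
          0# ∎
          where
          ρ′ : I → Carrier
          ρ′ y = ι (s y ℕ.+ update _≟_ x i g y)

          -- Slices no longer contain `x`, so moving the coordinate `x` changes the argument of the
          -- Horner polynomial but not its coefficients.
          independent : ∀ e → evaluate (slice x e P) ρ′ ≈ evaluate (slice x e P) ρ
          independent e = evaluate-local (slice x e P) (All-slice {S = λ _ → ⊤} x e P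
            (λ m _ → All.map (λ {y} x≢y → reflexive (≡.cong (λ j → ι (s y ℕ.+ j)) (update-≢ _≟_ x y i g x≢y)))
                               (All.all-filter (¬? ∘ (x ≟_)) m))
            (All.universal (λ _ → tt) P))

    -- Uniqueness from samples

    negate : Poly → Poly
    negate = map (λ (a , m) → - a , m)

    coefficient-negate : ∀ m Q → coefficient m (negate Q) ≈ - coefficient m Q
    coefficient-negate m []            = sym -0#≈0#
    coefficient-negate m ((a , m′) ∷ Q) = step (sameMonomial? m m′)
      where
      step : Dec (SameMonomial m m′) →
             coefficient m (negate ((a , m′) ∷ Q)) ≈ - coefficient m ((a , m′) ∷ Q)
      step (no ¬same) = begin
        coefficient m ((- a , m′) ∷ negate Q) ≡⟨ coefficient-reject m m′ (- a) (negate Q) ¬same ⟩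
        coefficient m (negate Q)              ≈⟨ coefficient-negate m Q ⟩
        - coefficient m Q                     ≡⟨ ≡.cong (-_) (coefficient-reject m m′ a Q ¬same) ⟨
        - coefficient m ((a , m′) ∷ Q)        ∎
      step (yes same) = begin
        coefficient m ((- a , m′) ∷ negate Q) ≡⟨ coefficient-accept m m′ (- a) (negate Q) same ⟩
        - a + coefficient m (negate Q)        ≈⟨ +-congˡ (coefficient-negate m Q) ⟩
        - a + - coefficient m Q               ≈⟨ -‿+-comm a (coefficient m Q) ⟩
        - (a + coefficient m Q)               ≡⟨ ≡.cong (-_) (coefficient-accept m m′ a Q same) ⟨
        - coefficient m ((a , m′) ∷ Q)        ∎

    coefficient-++ : ∀ m P Q → coefficient m (P ++ Q) ≈ coefficient m P + coefficient m Q
    coefficient-++ m []             Q = sym (+-identityˡ (coefficient m Q))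
    coefficient-++ m ((a , m′) ∷ P) Q = step (sameMonomial? m m′)
      where
      step : Dec (SameMonomial m m′) →
             coefficient m ((a , m′) ∷ P ++ Q) ≈ coefficient m ((a , m′) ∷ P) + coefficient m Q
      step (no ¬same) = begin
        coefficient m ((a , m′) ∷ P ++ Q)            ≡⟨ coefficient-reject m m′ a (P ++ Q) ¬same ⟩
        coefficient m (P ++ Q)                       ≈⟨ coefficient-++ m P Q ⟩
        coefficient m P + coefficient m Q
          ≡⟨ ≡.cong (_+ coefficient m Q) (coefficient-reject m m′ a P ¬same) ⟨
        coefficient m ((a , m′) ∷ P) + coefficient m Q ∎
      step (yes same) = begin
        coefficient m ((a , m′) ∷ P ++ Q)            ≡⟨ coefficient-accept m m′ a (P ++ Q) same ⟩
        a + coefficient m (P ++ Q)                   ≈⟨ +-congˡ (coefficient-++ m P Q) ⟩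
        a + (coefficient m P + coefficient m Q)      ≈⟨ +-assoc a _ _ ⟨
        a + coefficient m P + coefficient m Q
          ≡⟨ ≡.cong (_+ coefficient m Q) (coefficient-accept m m′ a P same) ⟨
        coefficient m ((a , m′) ∷ P) + coefficient m Q ∎

    evaluate-negate : ∀ Q ρ → evaluate (negate Q) ρ ≈ - evaluate Q ρ
    evaluate-negate []            ρ = sym -0#≈0#
    evaluate-negate ((a , m) ∷ Q) ρ = begin
      - a * productᴿ (map ρ m) + evaluate (negate Q) ρ
        ≈⟨ +-cong (sym (-‿distribˡ-* a (productᴿ (map ρ m)))) (evaluate-negate Q ρ) ⟩
      - (a * productᴿ (map ρ m)) + - evaluate Q ρ
        ≈⟨ -‿+-comm (a * productᴿ (map ρ m)) (evaluate Q ρ) ⟩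
      - (a * productᴿ (map ρ m) + evaluate Q ρ) ∎

    evaluate-++ : ∀ P Q ρ → evaluate (P ++ Q) ρ ≈ evaluate P ρ + evaluate Q ρ
    evaluate-++ []            Q ρ = sym (+-identityˡ (evaluate Q ρ))
    evaluate-++ ((a , m) ∷ P) Q ρ = trans (+-congˡ (evaluate-++ P Q ρ)) (sym (+-assoc _ _ _))

    grid-determines : ∀ (F : List I) d (s : I → ℕ) P Q →
      All (λ t → All (_∈ F) (proj₂ t)) (P ++ Q) →
      All (λ t → length (proj₂ t) ℕ.≤ d) (P ++ Q) →
      (∀ g → (∀ x → g x ℕ.≤ d) →
        evaluate P (λ x → ι (s x ℕ.+ g x)) ≈ evaluate Q (λ x → ι (s x ℕ.+ g x))) →
      ∀ m → coefficient m P ≈ coefficient m Q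
    grid-determines F d s P Q PQ⊆F PQ≤d P≈Q m = x∙y⁻¹≈ε⇒x≈y _ _ (begin
      coefficient m P - coefficient m Q          ≈⟨ +-congˡ (coefficient-negate m Q) ⟨
      coefficient m P + coefficient m (negate Q) ≈⟨ coefficient-++ m P (negate Q) ⟨
      coefficient m (P ++ negate Q)
        ≈⟨ grid-vanishing F d s (P ++ negate Q) (All-negate PQ⊆F) (All-negate PQ≤d) difference≈0 m ⟩
      0#                                         ∎)
      where
      All-negate : ∀ {ℓ′} {S : Monomial → Set ℓ′} →
                   All (S ∘ proj₂) (P ++ Q) → All (S ∘ proj₂) (P ++ negate Q)
      All-negate all = All.++⁺ (All.++⁻ˡ P all) (All.map⁺ (All.++⁻ʳ P all))

      difference≈0 : ∀ g → (∀ x → g x ℕ.≤ d) → evaluate (P ++ negate Q) (λ x → ι (s x ℕ.+ g x)) ≈ 0#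
      difference≈0 g g≤d = begin
        evaluate (P ++ negate Q) ρ            ≈⟨ evaluate-++ P (negate Q) ρ ⟩
        evaluate P ρ + evaluate (negate Q) ρ  ≈⟨ +-congˡ (evaluate-negate Q ρ) ⟩
        evaluate P ρ - evaluate Q ρ           ≈⟨ x≈y⇒x∙y⁻¹≈ε (P≈Q g g≤d) ⟩
        0#                                    ∎
        where
        ρ : I → Carrier
        ρ x = ι (s x ℕ.+ g x)

    -- Only finitely many variables and a finite degree occur in `P` and `Q`; hence the origin `s`
    -- of the grid may depend on `d` and `L`, and the samples need to hit it only on `L`. The values
    -- `τ` link the two polynomials at each sample.
    samples-determine : (σ : ℕ → I → ℕ) →
      (∀ d L → ∃[ s ] (∀ g → (∀ x → g x ℕ.≤ d) → ∃[ n ] All (λ x → σ n x ≡ s x ℕ.+ g x) L)) →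
      (ρ : ℕ → I → Carrier) → (∀ n x → ρ n x ≡ ι (σ n x)) →
      ∀ P Q (τ : ℕ → Carrier) →
      (∀ n → τ n ≈ evaluate P (ρ n)) → (∀ n → τ n ≈ evaluate Q (ρ n)) →
      ∀ m → coefficient m P ≈ coefficient m Q
    samples-determine σ grid ρ ρ≡ P Q τ τ≈P τ≈Q =
      grid-determines L d s P Q PQ⊆L (All.map⁻ (xs≤max 0 (map (length ∘ proj₂) (P ++ Q)))) agree
      where
      d : ℕ
      d = max 0 (map (length ∘ proj₂) (P ++ Q))

      L : List I
      L = concatMap proj₂ (P ++ Q)

      s : I → ℕ
      s = proj₁ (grid d L)

      PQ⊆L : All (λ t → All (_∈ L) (proj₂ t)) (P ++ Q)
      PQ⊆L = All.map⁻ (All.concat⁻ (All.tabulate id))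

      agree : ∀ g → (∀ x → g x ℕ.≤ d) →
              evaluate P (λ x → ι (s x ℕ.+ g x)) ≈ evaluate Q (λ x → ι (s x ℕ.+ g x))
      agree g g≤d with n , σ≡ ← proj₂ (grid d L) g g≤d = begin
        evaluate P (λ x → ι (s x ℕ.+ g x)) ≈⟨ at-n P (All.++⁻ˡ P PQ⊆L) ⟨
        evaluate P (ρ n)                   ≈⟨ τ≈P n ⟨
        τ n                                ≈⟨ τ≈Q n ⟩
        evaluate Q (ρ n)                   ≈⟨ at-n Q (All.++⁻ʳ P PQ⊆L) ⟩
        evaluate Q (λ x → ι (s x ℕ.+ g x)) ∎
        where
        at-n : ∀ R → All (λ t → All (_∈ L) (proj₂ t)) R →
               evaluate R (ρ n) ≈ evaluate R (λ x → ι (s x ℕ.+ g x))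
        at-n R R⊆L = evaluate-local R (All.map (All.map λ x∈L →
          reflexive (≡.trans (ρ≡ n _) (≡.cong ι (All.lookup σ≡ x∈L)))) R⊆L)

-- The complex numbers as a commutative ring

-- The algebraic ring laws hold term by term in the rationals, which leaves estimates to the
-- equivalence and congruence laws.
≗⇒≈ᴿ : ∀ {x y} → (∀ n → seq x n ≡ seq y n) → x ≈ᴿ y
≗⇒≈ᴿ {x} {y} x≗y ε 0<ε = 0 , λ n _ → ≡.subst (ℚ._< ε)
  (≡.cong ℚ.∣_∣ (≡.sym (≡.trans (≡.cong (ℚ._- seq y n) (x≗y n)) (ℚ.+-inverseʳ (seq y n))))) 0<ε

≈ᴿ-sym : ∀ {x y} → x ≈ᴿ y → y ≈ᴿ x
≈ᴿ-sym {x} {y} x≈y ε 0<ε = let N , h = x≈y ε 0<ε in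
  N , λ n N≤n → ≡.subst (ℚ._< ε)
    (≡.trans (≡.sym (ℚ.∣-p∣≡∣p∣ (seq x n ℚ.- seq y n)))
      (≡.cong ℚ.∣_∣ (solve 2 (λ a b → :- (a :- b) := b :- a) refl (seq x n) (seq y n))))
    (h n N≤n)
  where open +-*-Solver

≈ᴿ-+-cong : ∀ {x y u v} → x ≈ᴿ y → u ≈ᴿ v → x +ᴿ u ≈ᴿ y +ᴿ v
≈ᴿ-+-cong {x} {y} {u} {v} x≈y u≈v ε 0<ε =
  let M , h = x≈y (½ ℚ.* ε) (half-pos 0<ε)
      N , k = u≈v (½ ℚ.* ε) (half-pos 0<ε)
  in M ℕ.⊔ N , λ n l → begin-strict
      ℚ.∣ (seq x n ℚ.+ seq u n) ℚ.- (seq y n ℚ.+ seq v n) ∣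
        ≡⟨ ≡.cong ℚ.∣_∣ (solve 4 (λ a b c d → (a :+ b) :- (c :+ d) := (a :- c) :+ (b :- d)) refl
             (seq x n) (seq u n) (seq y n) (seq v n)) ⟩
      ℚ.∣ (seq x n ℚ.- seq y n) ℚ.+ (seq u n ℚ.- seq v n) ∣
        ≤⟨ ℚ.∣p+q∣≤∣p∣+∣q∣ (seq x n ℚ.- seq y n) (seq u n ℚ.- seq v n) ⟩
      ℚ.∣ seq x n ℚ.- seq y n ∣ ℚ.+ ℚ.∣ seq u n ℚ.- seq v n ∣
        <⟨ ℚ.+-mono-< (h n (ℕ.m⊔n≤o⇒m≤o M N l)) (k n (ℕ.m⊔n≤o⇒n≤o M N l)) ⟩
      ½ ℚ.* ε ℚ.+ ½ ℚ.* ε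
        ≡⟨ halves ε ⟩
      ε ∎
  where
  open ℚ.≤-Reasoning
  open +-*-Solver

≈ᴿ-trans : ∀ {x y z} → x ≈ᴿ y → y ≈ᴿ z → x ≈ᴿ z
≈ᴿ-trans {x} {y} {z} x≈y y≈z ε 0<ε =
  -- Adding the two equations gives x + y ≈ y + z, and `y` cancels in the difference.
  let N , h = ≈ᴿ-+-cong {x} {y} {y} {z} x≈y y≈z ε 0<ε
  in N , λ n N≤n → ≡.subst (λ q → ℚ.∣ q ∣ ℚ.< ε)
       (solve 3 (λ a b c → (a :+ b) :- (b :+ c) := a :- c) refl (seq x n) (seq y n) (seq z n))
       (h n N≤n)
  where open +-*-Solver

≈ᴿ-neg-cong : ∀ {x y} → x ≈ᴿ y → -ᴿ x ≈ᴿ -ᴿ y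
≈ᴿ-neg-cong {x} {y} x≈y ε 0<ε = let N , h = ≈ᴿ-sym {x} {y} x≈y ε 0<ε in
  N , λ n N≤n → ≡.subst (λ q → ℚ.∣ q ∣ ℚ.< ε)
    (solve 2 (λ a b → b :- a := (:- a) :- (:- b)) refl (seq x n) (seq y n)) (h n N≤n)
  where open +-*-Solver

≈ᴿ-*-cong : ∀ {x y u v} → x ≈ᴿ y → u ≈ᴿ v → x *ᴿ u ≈ᴿ y *ᴿ v
≈ᴿ-*-cong {x} {y} {u} {v} x≈y u≈v ε 0<ε =
  -- Bounds for `x` and `v` suffice because xu - yv = x(u - v) + v(x - y).
  let A , K , 0<A , bx = eventually-bounded (seq x) (cauchy x)
      B , L , 0<B , bv = eventually-bounded (seq v) (cauchy v)
      α , 0<α , Aα≡½ε  = split A 0<ε 0<A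
      β , 0<β , Bβ≡½ε  = split B 0<ε 0<B
      M , h            = x≈y β 0<β
      N , k            = u≈v α 0<α
  in (K ℕ.⊔ L) ℕ.⊔ (M ℕ.⊔ N) , λ n l →
    let KL≤n = ℕ.m⊔n≤o⇒m≤o (K ℕ.⊔ L) (M ℕ.⊔ N) l
        MN≤n = ℕ.m⊔n≤o⇒n≤o (K ℕ.⊔ L) (M ℕ.⊔ N) l
    in ≡.subst (ℚ.∣ seq x n ℚ.* seq u n ℚ.- seq y n ℚ.* seq v n ∣ ℚ.<_)
         (≡.trans (≡.cong₂ ℚ._+_ Aα≡½ε Bβ≡½ε) (halves ε))
         (*-close (seq x n) (seq u n) (seq y n) (seq v n) A B α β 0<A 0<B
           (bx n (ℕ.m⊔n≤o⇒m≤o K L KL≤n)) (bv n (ℕ.m⊔n≤o⇒n≤o K L KL≤n))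
           (k n (ℕ.m⊔n≤o⇒n≤o M N MN≤n)) (h n (ℕ.m⊔n≤o⇒m≤o M N MN≤n)))

open RawRing ℂ-rawRing using () renaming (_+_ to _+ᶜ_; _*_ to _*ᶜ_; -_ to -ᶜ_; 0# to 0ᶜ; 1# to 1ᶜ)

≗⇒≈ᶜ : ∀ {z w} → (∀ n → seq (re z) n ≡ seq (re w) n) → (∀ n → seq (im z) n ≡ seq (im w) n) → z ≈ᶜ w
≗⇒≈ᶜ {z} {w} re≗ im≗ = ≗⇒≈ᴿ {re z} {re w} re≗ , ≗⇒≈ᴿ {im z} {im w} im≗

≈ᶜ-refl : ∀ {z} → z ≈ᶜ z
≈ᶜ-refl {z} = ≗⇒≈ᶜ {z} {z} (λ _ → refl) (λ _ → refl)

ℂ-isCommutativeRing : IsCommutative ℂ-rawRing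
ℂ-isCommutativeRing = record
  { isRing = record
    { +-isAbelianGroup = record
      { isGroup = record
        { isMonoid = record
          { isSemigroup = record
            { isMagma = record
              { isEquivalence = record
                { refl  = λ {z} → ≈ᶜ-refl {z}
                ; sym   = λ {z} {w} (r , i) → ≈ᴿ-sym {re z} {re w} r , ≈ᴿ-sym {im z} {im w} i
                ; trans = λ {z} {w} {u} (r , i) (r′ , i′) →
                    ≈ᴿ-trans {re z} {re w} {re u} r r′ , ≈ᴿ-trans {im z} {im w} {im u} i i′
                }
              ; ∙-cong = λ {z} {z′} {w} {w′} (r , i) (r′ , i′) →
                  ≈ᴿ-+-cong {re z} {re z′} {re w} {re w′} r r′ ,
                  ≈ᴿ-+-cong {im z} {im z′} {im w} {im w′} i i′
              }
            ; assoc = λ z w u → ≗⇒≈ᶜ {(z +ᶜ w) +ᶜ u} {z +ᶜ (w +ᶜ u)}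
                (λ n → ℚ.+-assoc (seq (re z) n) (seq (re w) n) (seq (re u) n))
                (λ n → ℚ.+-assoc (seq (im z) n) (seq (im w) n) (seq (im u) n))
            }
          ; identity =
              (λ z → ≗⇒≈ᶜ {0ᶜ +ᶜ z} {z} (λ n → ℚ.+-identityˡ (seq (re z) n)) (λ n → ℚ.+-identityˡ (seq (im z) n))) ,
              (λ z → ≗⇒≈ᶜ {z +ᶜ 0ᶜ} {z} (λ n → ℚ.+-identityʳ (seq (re z) n)) (λ n → ℚ.+-identityʳ (seq (im z) n)))
          }
        ; inverse =
            (λ z → ≗⇒≈ᶜ {(-ᶜ z) +ᶜ z} {0ᶜ} (λ n → ℚ.+-inverseˡ (seq (re z) n)) (λ n → ℚ.+-inverseˡ (seq (im z) n))) ,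
            (λ z → ≗⇒≈ᶜ {z +ᶜ (-ᶜ z)} {0ᶜ} (λ n → ℚ.+-inverseʳ (seq (re z) n)) (λ n → ℚ.+-inverseʳ (seq (im z) n)))
        ; ⁻¹-cong = λ {z} {w} (r , i) → ≈ᴿ-neg-cong {re z} {re w} r , ≈ᴿ-neg-cong {im z} {im w} i
        }
      ; comm = λ z w → ≗⇒≈ᶜ {z +ᶜ w} {w +ᶜ z}
          (λ n → ℚ.+-comm (seq (re z) n) (seq (re w) n))
          (λ n → ℚ.+-comm (seq (im z) n) (seq (im w) n))
      }
    ; *-cong = λ {z} {z′} {w} {w′} → *ᶜ-cong {z} {z′} {w} {w′}
    ; *-assoc = λ z w u → ≗⇒≈ᶜ {(z *ᶜ w) *ᶜ u} {z *ᶜ (w *ᶜ u)}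
        (λ n → solve 6 (λ a b c d e f →
            (a :* c :+ :- (b :* d)) :* e :+ :- ((a :* d :+ b :* c) :* f) :=
            a :* (c :* e :+ :- (d :* f)) :+ :- (b :* (c :* f :+ d :* e))) refl
          (seq (re z) n) (seq (im z) n) (seq (re w) n) (seq (im w) n) (seq (re u) n) (seq (im u) n))
        (λ n → solve 6 (λ a b c d e f →
            (a :* c :+ :- (b :* d)) :* f :+ (a :* d :+ b :* c) :* e :=
            a :* (c :* f :+ d :* e) :+ b :* (c :* e :+ :- (d :* f))) refl
          (seq (re z) n) (seq (im z) n) (seq (re w) n) (seq (im w) n) (seq (re u) n) (seq (im u) n))
    ; *-identity =
        (λ z → ≗⇒≈ᶜ {1ᶜ *ᶜ z} {z}
          (λ n → solve 2 (λ a b → con 1ℚ :* a :+ :- (con 0ℚ :* b) := a) refl (seq (re z) n) (seq (im z) n))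
          (λ n → solve 2 (λ a b → con 1ℚ :* b :+ con 0ℚ :* a := b) refl (seq (re z) n) (seq (im z) n))) ,
        (λ z → ≗⇒≈ᶜ {z *ᶜ 1ᶜ} {z}
          (λ n → solve 2 (λ a b → a :* con 1ℚ :+ :- (b :* con 0ℚ) := a) refl (seq (re z) n) (seq (im z) n))
          (λ n → solve 2 (λ a b → a :* con 0ℚ :+ b :* con 1ℚ := b) refl (seq (re z) n) (seq (im z) n)))
    ; distrib =
        (λ z w u → ≗⇒≈ᶜ {z *ᶜ (w +ᶜ u)} {(z *ᶜ w) +ᶜ (z *ᶜ u)}
          (λ n → solve 6 (λ a b c d e f →
              a :* (c :+ e) :+ :- (b :* (d :+ f)) :=
              a :* c :+ :- (b :* d) :+ (a :* e :+ :- (b :* f))) refl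
            (seq (re z) n) (seq (im z) n) (seq (re w) n) (seq (im w) n) (seq (re u) n) (seq (im u) n))
          (λ n → solve 6 (λ a b c d e f →
              a :* (d :+ f) :+ b :* (c :+ e) := a :* d :+ b :* c :+ (a :* f :+ b :* e)) refl
            (seq (re z) n) (seq (im z) n) (seq (re w) n) (seq (im w) n) (seq (re u) n) (seq (im u) n))) ,
        (λ z w u → ≗⇒≈ᶜ {(w +ᶜ u) *ᶜ z} {(w *ᶜ z) +ᶜ (u *ᶜ z)}
          (λ n → solve 6 (λ a b c d e f →
              (c :+ e) :* a :+ :- ((d :+ f) :* b) :=
              c :* a :+ :- (d :* b) :+ (e :* a :+ :- (f :* b))) refl
            (seq (re z) n) (seq (im z) n) (seq (re w) n) (seq (im w) n) (seq (re u) n) (seq (im u) n))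
          (λ n → solve 6 (λ a b c d e f →
              (c :+ e) :* b :+ (d :+ f) :* a := c :* b :+ d :* a :+ (e :* b :+ f :* a)) refl
            (seq (re z) n) (seq (im z) n) (seq (re w) n) (seq (im w) n) (seq (re u) n) (seq (im u) n)))
    }
  ; *-comm = λ z w → ≗⇒≈ᶜ {z *ᶜ w} {w *ᶜ z}
      (λ n → solve 4 (λ a b c d → a :* c :+ :- (b :* d) := c :* a :+ :- (d :* b)) refl
        (seq (re z) n) (seq (im z) n) (seq (re w) n) (seq (im w) n))
      (λ n → solve 4 (λ a b c d → a :* d :+ b :* c := c :* b :+ d :* a) refl
        (seq (re z) n) (seq (im z) n) (seq (re w) n) (seq (im w) n))
  }
  where
  open +-*-Solver

  *ᶜ-cong : ∀ {z z′ w w′} → z ≈ᶜ z′ → w ≈ᶜ w′ → z *ᶜ w ≈ᶜ z′ *ᶜ w′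
  *ᶜ-cong {a +i b} {a′ +i b′} {c +i d} {c′ +i d′} (a≈ , b≈) (c≈ , d≈) =
    ≈ᴿ-+-cong {a *ᴿ c} {a′ *ᴿ c′} { -ᴿ (b *ᴿ d)} { -ᴿ (b′ *ᴿ d′)}
      (≈ᴿ-*-cong {a} {a′} {c} {c′} a≈ c≈)
      (≈ᴿ-neg-cong {b *ᴿ d} {b′ *ᴿ d′} (≈ᴿ-*-cong {b} {b′} {d} {d′} b≈ d≈)) ,
    ≈ᴿ-+-cong {a *ᴿ d} {a′ *ᴿ d′} {b *ᴿ c} {b′ *ᴿ c′}
      (≈ᴿ-*-cong {a} {a′} {d} {d′} a≈ d≈) (≈ᴿ-*-cong {b} {b′} {c} {c′} b≈ c≈)

-- Natural numbers inside the complex numbers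

_/1 : ℕ → ℚ
n /1 = ℤ.+ n ℚ./ 1

-- The gcd in the normalisation of `n /1` blocks computation for a variable `n`; among unnormalised
-- fractions the denominator 1 stays visible.
toℚᵘ-/1 : ∀ n → ℚ.toℚᵘ (n /1) ℚᵘ.≃ mkℚᵘ (ℤ.+ n) 0
toℚᵘ-/1 n = ℚ.toℚᵘ-fromℚᵘ (mkℚᵘ (ℤ.+ n) 0)

/1-+ : ∀ m n → (m ℕ.+ n) /1 ≡ m /1 ℚ.+ n /1
/1-+ m n = ℚ.toℚᵘ-injective (begin
  ℚ.toℚᵘ ((m ℕ.+ n) /1)              ≈⟨ toℚᵘ-/1 (m ℕ.+ n) ⟩
  mkℚᵘ (ℤ.+ (m ℕ.+ n)) 0
    ≈⟨ *≡* (≡.cong (ℤ._* ℤ.+ 1) (≡.sym (≡.cong₂ ℤ._+_ (ℤ.*-identityʳ (ℤ.+ m)) (ℤ.*-identityʳ (ℤ.+ n))))) ⟩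
  mkℚᵘ (ℤ.+ m) 0 ℚᵘ.+ mkℚᵘ (ℤ.+ n) 0     ≈⟨ ℚᵘ.+-cong (toℚᵘ-/1 m) (toℚᵘ-/1 n) ⟨
  ℚ.toℚᵘ (m /1) ℚᵘ.+ ℚ.toℚᵘ (n /1)   ≈⟨ ℚ.toℚᵘ-homo-+ (m /1) (n /1) ⟨
  ℚ.toℚᵘ (m /1 ℚ.+ n /1)             ∎)
  where open ℚᵘ.≃-Reasoning

1≤1+n/1 : ∀ n → 1ℚ ℚ.≤ suc n /1
1≤1+n/1 n = ℚ.toℚᵘ-cancel-≤ (ℚᵘ.≤-respʳ-≃ (ℚᵘ.≃-sym (toℚᵘ-/1 (suc n)))
  (*≤* (ℤ.*-monoʳ-≤-nonNeg (ℤ.+ 1) (+≤+ (s≤s (z≤n {n}))))))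

fromℕ-+ : ∀ m n → fromℕ (m ℕ.+ n) ≈ᶜ fromℕ m +ᶜ fromℕ n
fromℕ-+ m n = ≗⇒≈ᶜ {fromℕ (m ℕ.+ n)} {fromℕ m +ᶜ fromℕ n} (λ _ → /1-+ m n) (λ _ → refl)

∣p∣≤∣q*p∣ : ∀ q p → 1ℚ ℚ.≤ q → ℚ.∣ p ∣ ℚ.≤ ℚ.∣ q ℚ.* p ∣
∣p∣≤∣q*p∣ q p 1≤q = begin
  ℚ.∣ p ∣              ≡⟨ ℚ.*-identityˡ ℚ.∣ p ∣ ⟨
  1ℚ ℚ.* ℚ.∣ p ∣       ≤⟨ ℚ.*-monoʳ-≤-nonNeg ℚ.∣ p ∣ {{ℚ.nonNegative (ℚ.0≤∣p∣ p)}} 1≤q ⟩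
  q ℚ.* ℚ.∣ p ∣        ≡⟨ ≡.cong (ℚ._* ℚ.∣ p ∣) (ℚ.0≤p⇒∣p∣≡p (ℚ.≤-trans (ℚ.nonNegative⁻¹ 1ℚ) 1≤q)) ⟨
  ℚ.∣ q ∣ ℚ.* ℚ.∣ p ∣  ≡⟨ ℚ.∣p*q∣≡∣p∣*∣q∣ q p ⟨
  ℚ.∣ q ℚ.* p ∣        ∎
  where open ℚ.≤-Reasoning

-- A factor of at least 1 does not decrease the distance from 0, so the same `N` serves for the same
-- `ε`.
scaled-null : ∀ q x y → 1ℚ ℚ.≤ q → (∀ n → seq y n ≡ q ℚ.* seq x n) → y ≈ᴿ fromℚᴿ 0ℚ → x ≈ᴿ fromℚᴿ 0ℚ
scaled-null q x y 1≤q y≗qx y≈0 ε 0<ε = let N , h = y≈0 ε 0<ε in N , λ n N≤n → begin-strict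
  ℚ.∣ seq x n ℚ.- 0ℚ ∣  ≡⟨ ≡.cong ℚ.∣_∣ (ℚ.+-identityʳ (seq x n)) ⟩
  ℚ.∣ seq x n ∣         ≤⟨ ∣p∣≤∣q*p∣ q (seq x n) 1≤q ⟩
  ℚ.∣ q ℚ.* seq x n ∣   ≡⟨ ≡.cong ℚ.∣_∣ (≡.trans (ℚ.+-identityʳ (seq y n)) (y≗qx n)) ⟨
  ℚ.∣ seq y n ℚ.- 0ℚ ∣  <⟨ h n N≤n ⟩
  ε                     ∎
  where open ℚ.≤-Reasoning

fromℕ-cancel : ∀ n z → fromℕ (suc n) *ᶜ z ≈ᶜ 0ᶜ → z ≈ᶜ 0ᶜ
fromℕ-cancel n z (re≈0 , im≈0) =
  scaled-null q (re z) (re (fromℕ (suc n) *ᶜ z)) (1≤1+n/1 n)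
    (λ k → solve 3 (λ q a b → q :* a :+ :- (con 0ℚ :* b) := q :* a) refl q (seq (re z) k) (seq (im z) k))
    re≈0 ,
  scaled-null q (im z) (im (fromℕ (suc n) *ᶜ z)) (1≤1+n/1 n)
    (λ k → solve 3 (λ q a b → q :* b :+ con 0ℚ :* a := q :* b) refl q (seq (re z) k) (seq (im z) k))
    im≈0
  where
  open +-*-Solver
  q = suc n /1

-- Occurrences of words in digit lists

last-lookup : ∀ {a} {A : Set a} {n} (v : Vec A (suc n)) → last v ≡ lookup v (Fin.fromℕ n)
last-lookup {n = zero}  (x ∷ []) = refl
last-lookup {n = suc n} (x ∷ v)  = last-lookup v

module Blocks (r : ℕ) where

  open import Data.Nat.Base using (_+_; _*_; _∸_; _≤_; _<_)

  p : ℕ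
  p = suc (suc r)

  Digit : Set
  Digit = Fin p

  top : Digit
  top = Fin.fromℕ (suc r)

  -- The default value models the infinite padding with zero digits, so a window may run past the
  -- end of the list.
  nth : List Digit → ℕ → Digit
  nth []      i       = Fin.zero
  nth (d ∷ l) zero    = d
  nth (d ∷ l) (suc i) = nth l i

  nth-beyond : ∀ l {i} → length l ≤ i → nth l i ≡ Fin.zero
  nth-beyond []      _         = refl
  nth-beyond (d ∷ l) (s≤s l≤i) = nth-beyond l l≤i

  nth-replicate-++ : ∀ {M} d l {i} → i < M → nth (replicate M d ++ l) i ≡ d
  nth-replicate-++ {suc M} d l {zero}  _         = refl
  nth-replicate-++ {suc M} d l {suc i} (s<s i<M) = nth-replicate-++ d l i<M

  nth-toList : ∀ {μ} (v : Vec Digit μ) k → nth (toList v) (toℕ k) ≡ lookup v k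
  nth-toList (d ∷ v) Fin.zero    = refl
  nth-toList (d ∷ v) (Fin.suc k) = nth-toList v k

  length-toList : ∀ {μ} (v : Vec Digit μ) → length (toList v) ≡ μ
  length-toList []      = refl
  length-toList (d ∷ v) = ≡.cong suc (length-toList v)

  window : ∀ μ → List Digit → Vec Digit μ
  window μ l = tabulate (nth l ∘ toℕ)

  _≟ᵛ_ : ∀ {μ} → DecidableEquality (Vec Digit μ)
  _≟ᵛ_ = Vec.≡-dec Fin._≟_

  matches : ∀ {μ} → Vec Digit μ → List Digit → ℕ
  matches v l = if does (window _ l ≟ᵛ v) then 1 else 0

  -- Start positions beyond the list see only padding, which no word with a nonzero leftmost digit
  -- matches; for such words nothing is missed.
  occ : ∀ {μ} → Vec Digit μ → List Digit → ℕ
  occ v []      = 0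
  occ v (d ∷ l) = matches v (d ∷ l) + occ v l

  matches≤1 : ∀ {μ} (v : Vec Digit μ) l → matches v l ≤ 1
  matches≤1 v l with does (window _ l ≟ᵛ v)
  ... | true  = s≤s z≤n
  ... | false = z≤n

  occ≤length : ∀ {μ} (v : Vec Digit μ) l → occ v l ≤ length l
  occ≤length v []      = z≤n
  occ≤length v (d ∷ l) = ℕ.+-mono-≤ (matches≤1 v (d ∷ l)) (occ≤length v l)

  matches-cong : ∀ {μ} (v : Vec Digit μ) x y → (∀ i → i < μ → nth x i ≡ nth y i) → matches v x ≡ matches v y
  matches-cong v x y x≈y =
    ≡.cong (λ u → if does (u ≟ᵛ v) then 1 else 0) (Vec.tabulate-cong λ k → x≈y (toℕ k) (Fin.toℕ<n k))

  nth-++-cong : ∀ {μ} B x y → (∀ i → i < μ → nth x i ≡ nth y i) →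
                ∀ i → i < μ → nth (B ++ x) i ≡ nth (B ++ y) i
  nth-++-cong []      x y x≈y i       i<μ = x≈y i i<μ
  nth-++-cong (d ∷ B) x y x≈y zero    i<μ = refl
  nth-++-cong (d ∷ B) x y x≈y (suc i) i<μ = nth-++-cong B x y x≈y i (ℕ.<-trans (ℕ.n<1+n i) i<μ)

  -- The number occ v (B ++ x) ∸ occ v x of occurrences starting in B depends
  -- on x only through its first μ digits.
  occ-++-cong : ∀ {μ} (v : Vec Digit μ) B x y → (∀ i → i < μ → nth x i ≡ nth y i) →
                occ v (B ++ x) + occ v y ≡ occ v (B ++ y) + occ v x
  occ-++-cong v []      x y x≈y = ℕ.+-comm (occ v x) (occ v y)
  occ-++-cong v (d ∷ B) x y x≈y = begin
    matches v (d ∷ B ++ x) + occ v (B ++ x) + occ v y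
      ≡⟨ ℕ.+-assoc (matches v (d ∷ B ++ x)) _ _ ⟩
    matches v (d ∷ B ++ x) + (occ v (B ++ x) + occ v y)
      ≡⟨ ≡.cong₂ _+_ (matches-cong v (d ∷ B ++ x) (d ∷ B ++ y) (nth-++-cong (d ∷ B) x y x≈y)) (occ-++-cong v B x y x≈y) ⟩
    matches v (d ∷ B ++ y) + (occ v (B ++ y) + occ v x)
      ≡⟨ ℕ.+-assoc (matches v (d ∷ B ++ y)) _ _ ⟨
    matches v (d ∷ B ++ y) + occ v (B ++ y) + occ v x ∎
    where open ≡-Reasoning

  matches-≢ : ∀ {μ} (v : Vec Digit μ) l → window _ l ≢ v → matches v l ≡ 0
  matches-≢ v l ≢v = ≡.cong (if_then 1 else 0) (dec-false (window _ l ≟ᵛ v) ≢v)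

  window-toList : ∀ {μ} (u : Vec Digit μ) → window _ (toList u) ≡ u
  window-toList u = ≡.trans (Vec.tabulate-cong (nth-toList u)) (Vec.tabulate∘lookup u)

  matches-self : ∀ {μ} (v : Vec Digit μ) → matches v (toList v) ≡ 1
  matches-self v = ≡.cong (if_then 1 else 0) (dec-true (window _ (toList v) ≟ᵛ v) (window-toList v))

  -- A window starting in `w` is too short to tell `M` zeros from the padding after the end of `w`,
  -- whence the comparison with the empty list.
  occ-before-zeros : ∀ {μ} (v : Vec Digit μ) {M} → μ ≤ M → ∀ w l →
    occ v (w ++ replicate M Fin.zero ++ l) ≡ occ v w + occ v (replicate M Fin.zero ++ l)
  occ-before-zeros v {M} v≤M w l = begin
    occ v (w ++ zs)              ≡⟨ ℕ.+-identityʳ _ ⟨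
    occ v (w ++ zs) + occ v []
      ≡⟨ occ-++-cong v w zs [] (λ i i<v → nth-replicate-++ Fin.zero l (ℕ.<-≤-trans i<v v≤M)) ⟩
    occ v (w ++ []) + occ v zs   ≡⟨ ≡.cong (λ x → occ v x + occ v zs) (++-identityʳ w) ⟩
    occ v w + occ v zs           ∎
    where
    open ≡-Reasoning
    zs = replicate M Fin.zero ++ l

  module _ {n} (v : Vec Digit (suc n)) (last≢0 : last v ≢ Fin.zero) where

    window≢-last : ∀ l → nth l n ≡ Fin.zero → window _ l ≢ v
    window≢-last l nth≡0 eq = last≢0 (begin
      last v                                    ≡⟨ last-lookup v ⟩
      lookup v (Fin.fromℕ n)                    ≡⟨ ≡.cong (λ u → lookup u (Fin.fromℕ n)) eq ⟨
      lookup (window (suc n) l) (Fin.fromℕ n)   ≡⟨ Vec.lookup∘tabulate (nth l ∘ toℕ) (Fin.fromℕ n) ⟩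
      nth l (toℕ (Fin.fromℕ n))                 ≡⟨ ≡.cong (nth l) (Fin.toℕ-fromℕ n) ⟩
      nth l n                                   ≡⟨ nth≡0 ⟩
      Fin.zero                                  ∎)
      where open ≡-Reasoning

    occ-short : ∀ l → length l ≤ n → occ v l ≡ 0
    occ-short []      _   = refl
    occ-short (d ∷ l) l≤n = ≡.cong₂ _+_
      (matches-≢ v (d ∷ l) (window≢-last (d ∷ l) (nth-beyond (d ∷ l) l≤n)))
      (occ-short l (ℕ.≤-trans (ℕ.n≤1+n _) l≤n))

    occ-zeros : ∀ l → (∀ i → nth l i ≡ Fin.zero) → occ v l ≡ 0
    occ-zeros []      l≡0 = refl
    occ-zeros (d ∷ l) l≡0 = ≡.cong₂ _+_
      (matches-≢ v (d ∷ l) (window≢-last (d ∷ l) (l≡0 n))) (occ-zeros l (l≡0 ∘ suc))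

    -- At equal length only the window at position 0 avoids the padding; every later one has
    -- leftmost digit 0.
    occ-≢ : (u : Vec Digit (suc n)) → u ≢ v → occ v (toList u) ≡ 0
    occ-≢ u@(d ∷ u′) u≢v = ≡.cong₂ _+_
      (matches-≢ v (toList u) (u≢v ∘ ≡.trans (≡.sym (window-toList u))))
      (occ-short (toList u′) (ℕ.≤-reflexive (length-toList u′)))

    occ-self : occ v (toList v) ≡ 1
    occ-self = helper v refl
      where
      helper : ∀ u → u ≡ v → occ v (toList u) ≡ 1
      helper u@(d ∷ u′) refl = ≡.cong₂ _+_ (matches-self v)
        (occ-short (toList u′) (ℕ.≤-reflexive (length-toList u′)))

  module _ {n} (v : Vec Digit (suc n)) (head≢top : head v ≢ top) where

    window≢-head : ∀ l → nth l 0 ≡ top → window _ l ≢ v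
    window≢-head l nth≡top eq = head≢top (≡.trans (≡.cong head (≡.sym eq)) nth≡top)

    occ-tops : ∀ M l → occ v (replicate M top ++ l) ≡ occ v l
    occ-tops zero    l = refl
    occ-tops (suc M) l = ≡.cong₂ _+_
      (matches-≢ v (top ∷ replicate M top ++ l) (window≢-head (top ∷ replicate M top ++ l) refl)) (occ-tops M l)

    -- Windows starting in `w` do not reach past the `M` top digits, and windows starting at a top
    -- digit never match, so no occurrence runs into `l` from outside.
    occ-before-tops : ∀ {M} → suc n ≤ M → ∀ w l →
      occ v (w ++ replicate M top ++ l) ≡ occ v (w ++ replicate M top) + occ v l
    occ-before-tops {M} v≤M w l = begin
      occ v (w ++ ts ++ l)                   ≡⟨ ℕ.+-identityʳ _ ⟨
      occ v (w ++ ts ++ l) + 0               ≡⟨ ≡.cong (occ v (w ++ ts ++ l) +_) no-tops ⟨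
      occ v (w ++ ts ++ l) + occ v ts        ≡⟨ occ-++-cong v w (ts ++ l) ts agree ⟩
      occ v (w ++ ts) + occ v (ts ++ l)      ≡⟨ ≡.cong (occ v (w ++ ts) +_) (occ-tops M l) ⟩
      occ v (w ++ ts) + occ v l              ∎
      where
      open ≡-Reasoning
      ts = replicate M top

      no-tops : occ v ts ≡ 0
      no-tops = ≡.trans (≡.cong (occ v) (≡.sym (++-identityʳ ts))) (occ-tops M [])

      agree : ∀ i → i < suc n → nth (ts ++ l) i ≡ nth ts i
      agree i i<v = ≡.trans (nth-replicate-++ top l (ℕ.<-≤-trans i<v v≤M))
        (≡.sym (≡.trans (≡.cong (λ x → nth x i) (≡.sym (++-identityʳ ts)))
                        (nth-replicate-++ top [] (ℕ.<-≤-trans i<v v≤M))))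

  -- Digit lists start with the least significant digit.  The zeros agree with
  -- the padding beyond the end of a list, so they isolate the word before them;
  -- no word of W begins with top, which isolates the word after the separator.
  separator : ℕ → List Digit
  separator M = replicate M Fin.zero ++ replicate M top

  block : ℕ → List Digit → List Digit
  block M w = w ++ separator M

  occs : ∀ {μ} → Vec Digit μ → List (List Digit) → ℕ
  occs v ws = sum (map (occ v) ws)

  occ-blocks : ∀ {n} (v : Vec Digit (suc n)) → head v ≢ top → ∀ {M} → suc n ≤ M →
               ∀ ws → occ v (concatMap (block M) ws) ≡ occs v ws + length ws * occ v (separator M)
  occ-blocks v head≢top     v≤M []       = refl
  occ-blocks v head≢top {M} v≤M (w ∷ ws) = begin
    occ v (block M w ++ l)
      ≡⟨ ≡.cong (occ v) (≡.trans (++-assoc w _ l) (≡.cong (w ++_) (++-assoc zs ts l))) ⟩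
    occ v (w ++ zs ++ ts ++ l)
      ≡⟨ occ-before-zeros v v≤M w (ts ++ l) ⟩
    occ v w + occ v (zs ++ ts ++ l)
      ≡⟨ ≡.cong (occ v w +_) (occ-before-tops v head≢top v≤M zs l) ⟩
    occ v w + (c + occ v l)
      ≡⟨ ≡.cong (λ k → occ v w + (c + k)) (occ-blocks v head≢top v≤M ws) ⟩
    occ v w + (c + (occs v ws + length ws * c))
      ≡⟨ solve 4 (λ a c s t → a :+ (c :+ (s :+ t)) := a :+ s :+ (c :+ t)) refl
           (occ v w) c (occs v ws) (length ws * c) ⟩
    occ v w + occs v ws + (c + length ws * c) ∎
    where
    open ≡-Reasoning
    open ℕ-Solver.+-*-Solver
    l  = concatMap (block M) ws
    zs = replicate M Fin.zero
    ts = replicate M top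
    c  = occ v (separator M)

  -- From digit lists to integers

  value : List Digit → ℕ
  value []      = 0
  value (d ∷ l) = toℕ d + value l * p

  shifted : ℕ → ℕ → ℕ
  shifted n i = n / p ℕ.^ i
    where instance _ = ℕ.m^n≢0 p i

  toℕ-digit : ∀ n i → toℕ (digit p n i) ≡ shifted n i % p
  toℕ-digit n i = Fin.toℕ-fromℕ< _

  shifted-suc : ∀ n i → shifted n (suc i) ≡ shifted (n / p) i
  shifted-suc n i = ≡.sym (ℕ.m/n/o≡m/[n*o] n p (p ℕ.^ i))
    where instance
      _ = ℕ.m^n≢0 p i
      _ = ℕ.m^n≢0 p (suc i)

  shifted-small : ∀ {n} i → n < p ℕ.^ i → shifted n i ≡ 0
  shifted-small i = ℕ.m<n⇒m/n≡0
    where instance _ = ℕ.m^n≢0 p i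

  value-/p : ∀ d l → value (d ∷ l) / p ≡ value l
  value-/p d l = begin
    (toℕ d + value l * p) / p       ≡⟨ ℕ.+-distrib-/-∣ʳ (toℕ d) (n∣m*n (value l)) ⟩
    toℕ d / p + value l * p / p     ≡⟨ ≡.cong₂ _+_ (ℕ.m<n⇒m/n≡0 (Fin.toℕ<n d)) (ℕ.m*n/n≡m (value l) p) ⟩
    value l                         ∎
    where open ≡-Reasoning

  shifted-value : ∀ l i → shifted (value l) i % p ≡ toℕ (nth l i)
  shifted-value []      i    = ≡.cong (_% p) (shifted-small i (ℕ.m^n>0 p i))
  shifted-value (d ∷ l) zero = begin
    (value (d ∷ l) / 1) % p        ≡⟨ ≡.cong (_% p) (ℕ.n/1≡n (value (d ∷ l))) ⟩
    (toℕ d + value l * p) % p      ≡⟨ ℕ.[m+kn]%n≡m%n (toℕ d) (value l) p ⟩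
    toℕ d % p                      ≡⟨ ℕ.m<n⇒m%n≡m (Fin.toℕ<n d) ⟩
    toℕ d                          ∎
    where open ≡-Reasoning
  shifted-value (d ∷ l) (suc i) = begin
    shifted (value (d ∷ l)) (suc i) % p   ≡⟨ ≡.cong (_% p) (shifted-suc (value (d ∷ l)) i) ⟩
    shifted (value (d ∷ l) / p) i % p     ≡⟨ ≡.cong (λ n → shifted n i % p) (value-/p d l) ⟩
    shifted (value l) i % p               ≡⟨ shifted-value l i ⟩
    toℕ (nth l i)                         ∎
    where open ≡-Reasoning

  digit-value : ∀ l i → digit p (value l) i ≡ nth l i
  digit-value l i = Fin.toℕ-injective (≡.trans (toℕ-digit (value l) i) (shifted-value l i))

  n<p^n : ∀ n → n < p ℕ.^ n
  n<p^n zero    = s≤s z≤n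
  n<p^n (suc n) = ℕ.≤-<-trans (n<p^n n) (ℕ.^-monoʳ-< p (s≤s (s≤s z≤n)) (ℕ.n<1+n n))

  -- Needed because `occurrences` inspects the positions below `value l`, which may be more or fewer
  -- than `length l`. It holds since `value l ≤ i < p ^ i`.
  nth-beyond-value : ∀ l i → value l ≤ i → nth l i ≡ Fin.zero
  nth-beyond-value l i l≤i = Fin.toℕ-injective (≡.trans (≡.sym (shifted-value l i))
    (≡.cong (_% p) (shifted-small i (ℕ.≤-<-trans l≤i (n<p^n i)))))

  length-filter-∷ : ∀ {a ℓ} {A : Set a} {P : A → Set ℓ} (P? : ∀ x → Dec (P x)) x xs →
    length (filter P? (x ∷ xs)) ≡ (if does (P? x) then 1 else 0) + length (filter P? xs)
  length-filter-∷ P? x xs with does (P? x)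
  ... | true  = refl
  ... | false = refl

  -- Generalised over `f` because the tail of `applyUpTo f` is `applyUpTo (f ∘ suc)`. Either cutoff
  -- may come first: when `N` is used up the rest of `l` is zero, and when `l` is used up `drop 1`
  -- keeps it empty while the remaining windows are all zero.
  count-windows : ∀ {n} (v : Vec Digit (suc n)) → last v ≢ Fin.zero →
    ∀ (δ : ℕ → Digit) f N l → (∀ i → N ≤ i → nth l i ≡ Fin.zero) → (∀ i k → δ (f i + k) ≡ nth l (i + k)) →
    length (filter (λ i → Vec.≡-dec Fin._≟_ (tabulate λ k → δ (i + toℕ k)) v) (applyUpTo f N)) ≡ occ v l
  count-windows v last≢0 δ f zero    l       beyond δ≡l =
    ≡.sym (occ-zeros v last≢0 l (λ i → beyond i z≤n))
  count-windows v last≢0 δ f (suc N) l beyond δ≡l = begin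
    length (filter P? (f 0 ∷ applyUpTo (f ∘ suc) N))
      ≡⟨ length-filter-∷ P? (f 0) _ ⟩
    (if does (P? (f 0)) then 1 else 0) + length (filter P? (applyUpTo (f ∘ suc) N))
      ≡⟨ ≡.cong₂ _+_
           (≡.cong (λ u → if does (u ≟ᵛ v) then 1 else 0) (Vec.tabulate-cong λ k → δ≡l 0 (toℕ k)))
           (count-windows v last≢0 δ (f ∘ suc) N (drop 1 l)
             (λ i N≤i → ≡.trans (nth-drop l i) (beyond (suc i) (s≤s N≤i)))
             (λ i k → ≡.trans (δ≡l (suc i) k) (≡.sym (nth-drop l (i + k))))) ⟩
    matches v l + occ v (drop 1 l)
      ≡⟨ matches+occ l ⟩
    occ v l ∎
    where
    open ≡-Reasoning
    P? = λ i → Vec.≡-dec Fin._≟_ (tabulate λ k → δ (i + toℕ k)) v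

    nth-drop : ∀ l i → nth (drop 1 l) i ≡ nth l (suc i)
    nth-drop []      i = refl
    nth-drop (d ∷ l) i = refl

    matches+occ : ∀ l → matches v l + occ v (drop 1 l) ≡ occ v l
    matches+occ []      = ≡.cong (_+ 0) (matches-≢ v [] (window≢-last v last≢0 [] refl))
    matches+occ (d ∷ l) = refl

  occurrences-value : ∀ {n} (v : Vec Digit (suc n)) → last v ≢ Fin.zero →
                      ∀ l → occurrences p (value l) v ≡ occ v l
  occurrences-value v last≢0 l =
    count-windows v last≢0 (digit p (value l)) id (value l) l
      (nth-beyond-value l) (λ i k → digit-value l (i + k))

  -- Back substitution over words sorted by length

  open W

  -- The side conditions of `W` are irrelevant fields, but a negation can be recovered from an
  -- irrelevant proof.
  word-last≢0 : ∀ v → last (word {p} v) ≢ Fin.zero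
  word-last≢0 (mkW v ≢0 _) eq = ¬-recompute ≢0 (≡.cong toℕ eq)

  word-head≢top : ∀ v → head (word {p} v) ≢ top
  word-head≢top (mkW v _ ≢p-1) eq = ¬-recompute ≢p-1 (≡.trans (≡.cong toℕ eq) (Fin.toℕ-fromℕ (suc r)))

  digits : W p → List Digit
  digits v = toList (word v)

  -- Distinct words of equal length are related both ways: neither occurs in the other, so their
  -- relative order is immaterial.
  _≼_ : W p → W p → Set
  v ≼ u = k v ≤ k u × v ≢ u

  open DecMembership (_≟ᵂ_ {p}) using (_∈?_)

  insert : W p → List (W p) → List (W p)
  insert v []      = v ∷ []
  insert v (u ∷ F) with k v ℕ.≤? k u
  ... | yes _ = v ∷ u ∷ F
  ... | no  _ = u ∷ insert v F

  All-insert : ∀ {ℓ} {P : W p → Set ℓ} v F → P v → All P F → All P (insert v F)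
  All-insert v []      pv _        = pv ∷ []
  All-insert v (u ∷ F) pv (pu ∷ pF) with k v ℕ.≤? k u
  ... | yes _ = pv ∷ pu ∷ pF
  ... | no  _ = pu ∷ All-insert v F pv pF

  ∈-insert-here : ∀ v F → v ∈ insert v F
  ∈-insert-here v []      = here refl
  ∈-insert-here v (u ∷ F) with k v ℕ.≤? k u
  ... | yes _ = here refl
  ... | no  _ = there (∈-insert-here v F)

  ∈-insert-there : ∀ {x} v F → x ∈ F → x ∈ insert v F
  ∈-insert-there v (u ∷ F) x∈ with k v ℕ.≤? k u
  ∈-insert-there v (u ∷ F) x∈         | yes _ = there x∈
  ∈-insert-there v (u ∷ F) (here eq)  | no  _ = here eq
  ∈-insert-there v (u ∷ F) (there x∈) | no  _ = there (∈-insert-there v F x∈)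

  insert-sorted : ∀ v F → v ∉ F → AllPairs _≼_ F → AllPairs _≼_ (insert v F)
  insert-sorted v []      v∉ _            = [] ∷ []
  insert-sorted v (u ∷ F) v∉ (u≼F ∷ F≼) with k v ℕ.≤? k u
  ... | yes v≤u = ((v≤u , v∉ ∘ here) ∷ All.tabulate v≼) ∷ u≼F ∷ F≼
    where
    v≼ : ∀ {x} → x ∈ F → v ≼ x
    v≼ x∈F = ℕ.≤-trans v≤u (proj₁ (All.lookup u≼F x∈F)) , λ { refl → v∉ (there x∈F) }
  ... | no  v≰u = All-insert v F (ℕ.<⇒≤ (ℕ.≰⇒> v≰u) , v∉ ∘ here ∘ ≡.sym) u≼F ∷ insert-sorted v F (v∉ ∘ there) F≼

  sorted-cover : ∀ L → ∃[ F ] (All (_∈ F) L × AllPairs _≼_ F)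
  sorted-cover []      = [] , [] , []
  sorted-cover (v ∷ L) with sorted-cover L
  ... | F , L⊆F , F≼ with v ∈? F
  ...   | yes v∈F = F , v∈F ∷ L⊆F , F≼
  ...   | no  v∉F = insert v F , ∈-insert-here v F ∷ All.map (∈-insert-there v F) L⊆F , insert-sorted v F v∉F F≼

  -- The vanishing half of the unitriangular matrix, whose diagonal is `occ-self`: a strictly longer
  -- word always reaches into the zero padding with its leftmost digit.
  occ-longer : ∀ v u → v ≼ u → occ (word u) (digits v) ≡ 0
  occ-longer v@(mkW {i} _ _ _) u@(mkW {j} _ _ _) (v≤u , v≢u) with i ℕ.≟ j
  ... | no  i≢j  = occ-short (word u) (word-last≢0 u) (digits v)
    (ℕ.≤-trans (ℕ.≤-reflexive (length-toList (word v))) (s≤s (ℕ.≤∧≢⇒< v≤u i≢j)))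
  ... | yes refl = occ-≢ (word u) (word-last≢0 u) (word v) λ { refl → v≢u refl }

  occs-++ : ∀ {μ} (v : Vec Digit μ) ws ws′ → occs v (ws ++ ws′) ≡ occs v ws + occs v ws′
  occs-++ v ws ws′ = ≡.trans (≡.cong sum (map-++ (occ v) ws ws′)) (sum-++ (map (occ v) ws) (map (occ v) ws′))

  occs-replicate : ∀ {μ} (v : Vec Digit μ) m w → occs v (replicate m w) ≡ m * occ v w
  occs-replicate v zero    w = refl
  occs-replicate v (suc m) w = ≡.cong (occ v w +_) (occs-replicate v m w)

  -- Bounds both the number of words and the occurrences of any word in them.
  weight : List (List Digit) → ℕ
  weight ws = sum (map (suc ∘ length) ws)

  occs≤weight : ∀ {μ} (v : Vec Digit μ) ws → occs v ws ≤ weight ws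
  occs≤weight v []       = z≤n
  occs≤weight v (w ∷ ws) = ℕ.+-mono-≤ (ℕ.m≤n⇒m≤1+n (occ≤length v w)) (occs≤weight v ws)

  length≤weight : ∀ ws → length ws ≤ weight ws
  length≤weight []       = z≤n
  length≤weight (w ∷ ws) = s≤s (ℕ.≤-trans (length≤weight ws) (ℕ.m≤n+m (weight ws) (length w)))

  weight-++ : ∀ ws ws′ → weight (ws ++ ws′) ≡ weight ws + weight ws′
  weight-++ ws ws′ = ≡.trans (≡.cong sum (map-++ (suc ∘ length) ws ws′)) (sum-++ (map (suc ∘ length) ws) _)

  weight-replicate : ∀ m w → weight (replicate m w) ≡ m * suc (length w)
  weight-replicate zero    w = refl
  weight-replicate (suc m) w = ≡.cong (suc (length w) +_) (weight-replicate m w)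

  -- Back substitution: copies of v leave the counts of the longer words
  -- unchanged, so the count of v is adjusted after those of the longer words.
  prescribed-occs : ∀ d F → AllPairs _≼_ F →
    ∃[ s ] ∃[ B ] (∀ (g : W p → ℕ) → (∀ v → g v ≤ d) →
      ∃[ ws ] (weight ws ≤ B × All (λ v → occs (word v) ws ≡ s v + g v) F))
  prescribed-occs d []      _          = (λ _ → 0) , 0 , λ g g≤d → [] , z≤n , []
  prescribed-occs d (v ∷ F) (v≼F ∷ F≼) with prescribed-occs d F F≼
  -- The words chosen for `F` contain `v` at most `B` times, so from the origin `B` every target
  -- `B + g v` is reached by adding copies, and the truncated subtraction in `m` is exact. At most
  -- `B + d` copies are added, which gives the new bound.
  ... | s , B , solve = update _≟ᵂ_ v B s , (B + d) * suc (length (digits v)) + B , solve′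
    where
    solve′ : ∀ g → (∀ v → g v ≤ d) →
      ∃[ ws ] (weight ws ≤ (B + d) * suc (length (digits v)) + B ×
               All (λ u → occs (word u) ws ≡ update _≟ᵂ_ v B s u + g u) (v ∷ F))
    solve′ g g≤d with solve g g≤d
    ... | ws , ws≤B , ws-occs = copies ++ ws , weight≤ , occs-v ∷ All.tabulate occs-u
      where
      m = B + g v ∸ occs (word v) ws
      copies = replicate m (digits v)

      weight≤ : weight (copies ++ ws) ≤ (B + d) * suc (length (digits v)) + B
      weight≤ = begin
        weight (copies ++ ws)                   ≡⟨ weight-++ copies ws ⟩
        weight copies + weight ws               ≡⟨ ≡.cong (_+ weight ws) (weight-replicate m (digits v)) ⟩
        m * suc (length (digits v)) + weight ws
          ≤⟨ ℕ.+-mono-≤ (ℕ.*-monoˡ-≤ (suc (length (digits v))) m≤) ws≤B ⟩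
        (B + d) * suc (length (digits v)) + B   ∎
        where
        open ℕ.≤-Reasoning
        m≤ : m ≤ B + d
        m≤ = ℕ.≤-trans (ℕ.m∸n≤m (B + g v) (occs (word v) ws)) (ℕ.+-monoʳ-≤ B (g≤d v))

      occs-copies : ∀ u → occs (word u) (copies ++ ws) ≡ m * occ (word u) (digits v) + occs (word u) ws
      occs-copies u = ≡.trans (occs-++ (word u) copies ws)
        (≡.cong (_+ occs (word u) ws) (occs-replicate (word u) m (digits v)))

      occs-v : occs (word v) (copies ++ ws) ≡ update _≟ᵂ_ v B s v + g v
      occs-v = begin
        occs (word v) (copies ++ ws)                      ≡⟨ occs-copies v ⟩
        m * occ (word v) (digits v) + occs (word v) ws
          ≡⟨ ≡.cong (λ c → m * c + occs (word v) ws) (occ-self (word v) (word-last≢0 v)) ⟩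
        m * 1 + occs (word v) ws
          ≡⟨ ≡.cong (_+ occs (word v) ws) (ℕ.*-identityʳ m) ⟩
        m + occs (word v) ws
          ≡⟨ ℕ.m∸n+n≡m (ℕ.≤-trans (ℕ.≤-trans (occs≤weight (word v) ws) ws≤B) (ℕ.m≤m+n B (g v))) ⟩
        B + g v                                           ≡⟨ ≡.cong (_+ g v) (update-≡ _≟ᵂ_ v B s) ⟨
        update _≟ᵂ_ v B s v + g v                         ∎
        where open ≡-Reasoning

      occs-u : ∀ {u} → u ∈ F → occs (word u) (copies ++ ws) ≡ update _≟ᵂ_ v B s u + g u
      occs-u {u} u∈F = begin
        occs (word u) (copies ++ ws)                      ≡⟨ occs-copies u ⟩
        m * occ (word u) (digits v) + occs (word u) ws
          ≡⟨ ≡.cong (λ c → m * c + occs (word u) ws) (occ-longer v u (All.lookup v≼F u∈F)) ⟩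
        m * 0 + occs (word u) ws                          ≡⟨ ≡.cong (_+ occs (word u) ws) (ℕ.*-zeroʳ m) ⟩
        occs (word u) ws                                  ≡⟨ All.lookup ws-occs u∈F ⟩
        s u + g u
          ≡⟨ ≡.cong (_+ g u) (update-≢ _≟ᵂ_ v u B s (proj₂ (All.lookup v≼F u∈F))) ⟨
        update _≟ᵂ_ v B s u + g u                         ∎
        where open ≡-Reasoning

  -- Padding with empty words makes the number of blocks, and with it the
  -- contribution of the separators, independent of g.
  occurrences-grid : ∀ d F → AllPairs _≼_ F →
    ∃[ s ] (∀ (g : W p → ℕ) → (∀ v → g v ≤ d) →
      ∃[ n ] All (λ v → occurrences p n (word v) ≡ s v + g v) F)
  occurrences-grid d F F≼ with prescribed-occs d F F≼
  ... | s , B , solve = (λ v → s v + B * c v) , realize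
    where
    M : ℕ
    M = max 0 (map (λ v → 2 + k v) F)

    F≤M : All (λ v → 2 + k v ≤ M) F
    F≤M = All.map⁻ (xs≤max 0 (map (λ v → 2 + k v) F))

    c : W p → ℕ
    c v = occ (word v) (separator M)

    realize : ∀ g → (∀ v → g v ≤ d) → ∃[ n ] All (λ v → occurrences p n (word v) ≡ s v + B * c v + g v) F
    realize g g≤d with solve g g≤d
    ... | ws , ws≤B , ws-occs = value (concatMap (block M) padded) , All.zipWith count (F≤M , ws-occs)
      where
      padded : List (List Digit)
      padded = ws ++ replicate (B ∸ length ws) []

      length-padded : length padded ≡ B
      length-padded = begin
        length padded                                     ≡⟨ length-++ ws ⟩
        length ws + length (replicate (B ∸ length ws) [])
          ≡⟨ ≡.cong (length ws +_) (length-replicate (B ∸ length ws)) ⟩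
        length ws + (B ∸ length ws)
          ≡⟨ ℕ.m+[n∸m]≡n (ℕ.≤-trans (length≤weight ws) ws≤B) ⟩
        B                                                 ∎
        where open ≡-Reasoning

      occs-padded : ∀ v → occs (word v) padded ≡ occs (word v) ws
      occs-padded v = begin
        occs (word v) padded
          ≡⟨ occs-++ (word v) ws (replicate (B ∸ length ws) []) ⟩
        occs (word v) ws + occs (word v) (replicate (B ∸ length ws) [])
          ≡⟨ ≡.cong (occs (word v) ws +_) (occs-replicate (word v) (B ∸ length ws) []) ⟩
        occs (word v) ws + (B ∸ length ws) * 0
          ≡⟨ ≡.cong (occs (word v) ws +_) (ℕ.*-zeroʳ (B ∸ length ws)) ⟩
        occs (word v) ws + 0                                        ≡⟨ ℕ.+-identityʳ _ ⟩
        occs (word v) ws                                            ∎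
        where open ≡-Reasoning

      count : ∀ {v} → 2 + k v ≤ M × occs (word v) ws ≡ s v + g v →
              occurrences p (value (concatMap (block M) padded)) (word v) ≡ s v + B * c v + g v
      count {v} (v≤M , occs≡) = begin
        occurrences p (value (concatMap (block M) padded)) (word v)
          ≡⟨ occurrences-value (word v) (word-last≢0 v) (concatMap (block M) padded) ⟩
        occ (word v) (concatMap (block M) padded)
          ≡⟨ occ-blocks (word v) (word-head≢top v) v≤M padded ⟩
        occs (word v) padded + length padded * c v
          ≡⟨ ≡.cong₂ (λ a b → a + b * c v) (≡.trans (occs-padded v) occs≡) length-padded ⟩
        s v + g v + B * c v
          ≡⟨ ℕ.+-assoc (s v) (g v) (B * c v) ⟩
        s v + (g v + B * c v)
          ≡⟨ ≡.cong (s v +_) (ℕ.+-comm (g v) (B * c v)) ⟩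
        s v + (B * c v + g v)
          ≡⟨ ℕ.+-assoc (s v) (B * c v) (g v) ⟨
        s v + B * c v + g v ∎
        where open ≡-Reasoning

proposition2p1 : (p : ℕ) (p-prime : Prime p) (j : ℕ) (P Q : Polynomial p) →
    ((n : ℕ) → fromℚ (ϑ-ratio p-prime j n) ≈ᶜ eval P (occurrenceVector p-prime n)) →
    ((n : ℕ) → fromℚ (ϑ-ratio p-prime j n) ≈ᶜ eval Q (occurrenceVector p-prime n)) →
    P ≈ₚ Q
proposition2p1 zero          p-prime = contradiction p-prime ¬prime[0]
proposition2p1 (suc zero)    p-prime = contradiction p-prime ¬prime[1]
proposition2p1 (suc (suc r)) p-prime j P Q =
  samples-determine _≟ᵂ_ counts grid (occurrenceVector p-prime) (λ n v → refl)
    P Q (λ n → fromℚ (ϑ-ratio p-prime j n))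
  where
  open GridVanishing ℂ-rawRing ℂ-isCommutativeRing fromℕ fromℕ-+ fromℕ-cancel using (samples-determine)
  open Blocks r using (sorted-cover; occurrences-grid)

  -- The `NonZero` argument of `occurrences` is irrelevant, so these counts agree definitionally
  -- with those in `occurrences-grid`.
  counts : ℕ → W (suc (suc r)) → ℕ
  counts n v = occurrences (suc (suc r)) {{prime⇒nonZero p-prime}} n (W.word v)

  grid : ∀ d L → ∃[ s ] (∀ (g : W (suc (suc r)) → ℕ) → (∀ v → g v ℕ.≤ d) →
    ∃[ n ] All (λ v → counts n v ≡ s v ℕ.+ g v) L)
  -- The list `L` may be unsorted and repeat variables; the grid is built on a sorted list without
  -- repetitions that covers it, then restricted.
  grid d L with F , L⊆F , F≼ ← sorted-cover L with s , realize ← occurrences-grid d F F≼ =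
    s , λ g g≤d → let n , eqs = realize g g≤d in n , All.map (All.lookup eqs) L⊆F
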